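{- For every finite simple undirected graph $G$ there is a graph $H$ with $\mathrm{nim}(G) = \mathrm{nim}(H)$ such that $H$ has at most $2 \cdot \mathrm{nd}(G)$ vertices, where $\mathrm{nd}(G)$ is the neighborhood diversity of $G$. Moreover, such a graph $H$ can be computed from $G$ in linear time; that is, Node Kayles admits a polynomial kernelization with respect to neighborhood diversity (a kernel with at most $2 \cdot \mathrm{nd}(G)$ vertices).
   Context: All graphs are finite, simple and undirected. Node Kayles is the following two-player game on a graph $G=(V,E)$: the players alternately choose a vertex of the current graph, and the chosen vertex together with all its neighbors is removed from the graph; the player who makes the last move wins. The decision problem Node Kayles asks, given $G$, whether the first player has a winning strategy. Write $N_G(v) = \{w \in V : \{v,w\} \in E\}$ and $N_G[v] = N_G(v) \cup \{v\}$. The nimber $\mathrm{nim}(G)$ is defined recursively by $\mathrm{nim}(G) = 0$ if $G$ has no vertices, and otherwise $\mathrm{nim}(G) = \mathrm{mex}(\{\mathrm{nim}(G[V \setminus N_G[v]]) : v \in V\})$, where $\mathrm{mex}(S)$ is the smallest non-negative integer not in $S$. (The first player has a winning strategy on $G$ if and only if $\mathrm{nim}(G) > 0$.) A set $M \subseteq V$ is a module of $G$ if for every $v \in V \setminus M$, either $M \cap N_G(v) = \emptyset$ or $M \subseteq N_G(v)$. A module is a clique module if it is a clique of $G$, and an independent module if it is an independent set of $G$. The neighborhood diversity $\mathrm{nd}(G)$ is the minimum integer $k$ such that $V$ can be partitioned into $k$ modules of $G$, each of which is a clique module or an independent module. Linear time means time linear in the number of vertices plus edges of $G$. -}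

module Defs where

open import Data.Bool.Base using (Bool; true; false; if_then_else_)
open import Data.Fin.Base using (Fin; toℕ)
import Data.Fin.Properties as Fin
open import Data.Fin.Subset
  using (Subset; _∈_; _∉_; _⊆_; _⊂_; _∩_; _∪_; _─_; ⁅_⁆; ⊤; Nonempty; Empty)
open import Data.Fin.Subset.Induction using (⊂-wellFounded)
open import Data.Fin.Subset.Properties
  using (_∈?_; _⊆?_; nonempty?; p∩q≢∅⇒p─q⊂p; x∈p∩q⁺; x∈p∩q⁻; x∈p∪q⁺; x∈⁅x⁆)
open import Data.List.Base
  using (List; []; _∷_; map; mapMaybe; filter; length; concatMap; cartesianProduct; allFin; upTo)
import Data.List.Extrema.Nat as Extrema
open import Data.List.Membership.DecPropositional using () renaming (_∈?_ to member?)
import Data.List.Membership.Propositional as List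
open import Data.List.Properties using (map-cong)
open import Data.List.Relation.Unary.All using (lookup)
open import Data.List.Relation.Unary.Unique.Propositional using (Unique)
import Data.Maybe.Base as Maybe
open import Data.Nat.Base using (ℕ; zero; suc; pred; _+_; _*_; _^_; _≤_; _≡ᵇ_; _<ᵇ_; z≤n; s≤s)
open import Data.Nat.Properties using (_≟_; 1+n≰n)
open import Data.Product using (∃; ∃-syntax; _×_; _,_; proj₁; proj₂)
open import Data.Sum.Base using (_⊎_; inj₁; inj₂)
open import Data.Vec.Base using (Vec; tabulate)
import Data.Vec.Base as Vec
import Data.Vec.Properties as Vec
open import Function.Base using (_∘_)
open import Function.Bundles using (_⇔_)
open import Induction.WellFounded using (WfRec; module All; module FixPoint)
open import Level using (0ℓ)
open import Relation.Binary.Core using (Rel)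
open import Relation.Binary.Definitions using (Symmetric; Irreflexive; Decidable)
open import Relation.Binary.PropositionalEquality
  using (_≡_; _≢_; refl; sym; trans; cong; subst)
open import Relation.Nullary
  using (Dec; yes; no; does; ¬_; ¬?; contradiction; _×-dec_; _⊎-dec_; _→-dec_)
open import Relation.Nullary.Decidable using (map′; dec⇒maybe; dec-true)
import Relation.Unary as U

------------------------------------------------------------------------
-- Least natural numbers

IsLeast : (ℕ → Set) → ℕ → Set
IsLeast P k = P k × (∀ j → P j → k ≤ j)

least : {P : ℕ → Set} → U.Decidable P → ∀ n → P n → ∃ (IsLeast P)
least P? zero p = 0 , p , λ _ _ → z≤n
least P? (suc n) p with P? 0
... | yes p₀ = 0 , p₀ , λ _ _ → z≤n
... | no ¬p₀ with least (P? ∘ suc) n p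
...   | k , pk , min = suc k , pk , λ where
          zero    p₀ → contradiction p₀ ¬p₀
          (suc j) pj → s≤s (min j pj)

mex-search : (xs : List ℕ) → ∃ (IsLeast (λ k → k List.∉ xs))
mex-search xs = least (λ k → ¬? (member? _≟_ k xs)) (suc (Extrema.max 0 xs))
  (λ big∈xs → 1+n≰n (lookup (Extrema.xs≤max 0 xs) big∈xs))

opaque
  mex : List ℕ → ℕ
  mex xs = proj₁ (mex-search xs)

  mex-least : ∀ xs → IsLeast (λ k → k List.∉ xs) (mex xs)
  mex-least xs = proj₂ (mex-search xs)

------------------------------------------------------------------------
-- Finite simple graphs

record Graph : Set₁ where
  field
    order  : ℕ
    Adj    : Rel (Fin order) 0ℓ
    adj?   : Decidable Adj
    symm   : Symmetric Adj
    irrefl : Irreflexive _≡_ Adj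

  N : Fin order → Subset order
  N v = tabulate (λ w → does (adj? v w))

  N[_] : Fin order → Subset order
  N[ v ] = N v ∪ ⁅ v ⁆

  edges : List (Fin order × Fin order)
  edges = filter (λ (u , v) → (u Fin.<? v) ×-dec adj? u v)
                 (cartesianProduct (allFin order) (allFin order))

  size : ℕ
  size = order + length edges

open Graph using (order; size)

------------------------------------------------------------------------
-- Node Kayles and nimbers

-- A position of the game is an induced subgraph G[S] of the initial
-- graph, represented by the set S of vertices that are still present.
-- Choosing v in G[S] leaves G[S ∖ N[v]].

module _ (G : Graph) where
  open Graph G using (N[_])

  -- The player to move on G[S] has a winning strategy: a move after
  -- which every reply of the opponent leads again to such a position.
  data Wins (S : Subset (order G)) : Set where
    choose : ∀ v → v ∈ S →
             (∀ w → w ∈ S ─ N[ v ] → Wins ((S ─ N[ v ]) ─ N[ w ])) →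
             Wins S

  private
    shrinks : ∀ {v S} → v ∈ S → S ─ N[ v ] ⊂ S
    shrinks {v} {S} v∈S =
      p∩q≢∅⇒p─q⊂p S N[ v ] (v , x∈p∩q⁺ (v∈S , x∈p∪q⁺ (inj₂ (x∈⁅x⁆ v))))

  members : (S : Subset (order G)) → List (∃ λ v → v ∈ S)
  members S = mapMaybe (λ v → Maybe.map (v ,_) (dec⇒maybe (v ∈? S))) (allFin (order G))

  private
    nim-step : ∀ S → WfRec _⊂_ (λ _ → ℕ) S → ℕ
    nim-step S rec = mex (map (λ (v , v∈S) → rec (shrinks v∈S)) (members S))

    members-filter : ∀ S (f : Subset (order G) → ℕ) vs →
      map (λ (v , _) → f (S ─ N[ v ]))
          (mapMaybe (λ v → Maybe.map (v ,_) (dec⇒maybe (v ∈? S))) vs)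
      ≡ map (λ v → f (S ─ N[ v ])) (filter (_∈? S) vs)
    members-filter S f [] = refl
    members-filter S f (v ∷ vs) with v ∈? S
    ... | yes _ = cong (f (S ─ N[ v ]) ∷_) (members-filter S f vs)
    ... | no  _ = members-filter S f vs

  -- nimOn S is the nimber of G[S].  It is opaque only to stop the type
  -- checker from normalising it; nimOn-unfold is its recursive equation.
  opaque
    nimOn : Subset (order G) → ℕ
    nimOn = All.wfRec ⊂-wellFounded 0ℓ (λ _ → ℕ) nim-step

    nimOn-unfold : ∀ S →
      nimOn S ≡ mex (map (λ v → nimOn (S ─ N[ v ])) (filter (_∈? S) (allFin (order G))))
    nimOn-unfold S = trans
      (FixPoint.unfold-wfRec ⊂-wellFounded (λ _ → ℕ) nim-step
        (λ S eq → cong mex (map-cong (λ _ → eq _) (members S))) {S})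
      (cong mex (members-filter S nimOn (allFin (order G))))

nim : Graph → ℕ
nim G = nimOn G ⊤

NodeKayles : Graph → Set
NodeKayles G = Wins G ⊤

------------------------------------------------------------------------
-- Neighborhood diversity

module _ (G : Graph) where
  open Graph G using (Adj; adj?; N; irrefl)

  IsModule : Subset (order G) → Set
  IsModule M = ∀ v → v ∉ M → Empty (M ∩ N v) ⊎ M ⊆ N v

  IsClique : Subset (order G) → Set
  IsClique M = ∀ u v → u ∈ M → v ∈ M → u ≢ v → Adj u v

  IsIndependent : Subset (order G) → Set
  IsIndependent M = ∀ u v → u ∈ M → v ∈ M → ¬ Adj u v

  -- A partition into k parts is given by the label, in Fin k, of the
  -- part of each vertex.
  part : ∀ {k} → Vec (Fin k) (order G) → Fin k → Subset (order G)
  part p i = tabulate (λ v → does (Vec.lookup p v Fin.≟ i))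

  IsModulePartition : ∀ {k} → Vec (Fin k) (order G) → Set
  IsModulePartition p = ∀ i →
    Nonempty (part p i) ×
    IsModule (part p i) ×
    (IsClique (part p i) ⊎ IsIndependent (part p i))

  HasModulePartition : ℕ → Set
  HasModulePartition k = ∃ λ (p : Vec (Fin k) (order G)) → IsModulePartition p

  private
    isModule? : U.Decidable IsModule
    isModule? M = Fin.all? λ v →
      ¬? (v ∈? M) →-dec (¬? (nonempty? (M ∩ N v)) ⊎-dec (M ⊆? N v))

    isClique? : U.Decidable IsClique
    isClique? M = Fin.all? λ u → Fin.all? λ v →
      (u ∈? M) →-dec ((v ∈? M) →-dec (¬? (u Fin.≟ v) →-dec adj? u v))

    isIndependent? : U.Decidable IsIndependent
    isIndependent? M = Fin.all? λ u → Fin.all? λ v →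
      (u ∈? M) →-dec ((v ∈? M) →-dec ¬? (adj? u v))

    isModulePartition? : ∀ {k} → U.Decidable (IsModulePartition {k})
    isModulePartition? p = Fin.all? λ i →
      nonempty? (part p i) ×-dec
      (isModule? (part p i) ×-dec (isClique? (part p i) ⊎-dec isIndependent? (part p i)))

    anyVec? : ∀ {k n} {P : Vec (Fin k) n → Set} → U.Decidable P → Dec (∃ P)
    anyVec? {n = zero}  P? = map′ (Vec.[] ,_) (λ { (Vec.[] , p) → p }) (P? Vec.[])
    anyVec? {n = suc n} P? = map′
      (λ (x , xs , p) → x Vec.∷ xs , p)
      (λ { (x Vec.∷ xs , p) → x , xs , p })
      (Fin.any? λ x → anyVec? λ xs → P? (x Vec.∷ xs))

    hasModulePartition? : U.Decidable HasModulePartition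
    hasModulePartition? k = anyVec? isModulePartition?

  part-∈⁺ : ∀ {k} (p : Vec (Fin k) (order G)) {i v} → Vec.lookup p v ≡ i → v ∈ part p i
  part-∈⁺ p {i} {v} eq = Vec.lookup⇒[]= v _
    (trans (Vec.lookup∘tabulate _ v) (dec-true (Vec.lookup p v Fin.≟ i) eq))

  part-∈⁻ : ∀ {k} (p : Vec (Fin k) (order G)) {i v} → v ∈ part p i → Vec.lookup p v ≡ i
  part-∈⁻ p {i} {v} v∈ with Vec.lookup p v Fin.≟ i
                          | trans (sym (Vec.lookup∘tabulate (λ w → does (Vec.lookup p w Fin.≟ i)) v))
                                  (Vec.[]=⇒lookup v∈)
  ... | yes eq | _  = eq
  ... | no  _  | ()

  singletons : HasModulePartition (order G)
  singletons = p , λ i →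
      (i , part-∈⁺ p (Vec.lookup-allFin i))
    , (λ v _ → isolate i v)
    , inj₂ (λ u v u∈ v∈ → irrefl (trans (label u∈) (sym (label v∈))))
    where
    p = Vec.allFin (order G)

    label : ∀ {i v} → v ∈ part p i → v ≡ i
    label {v = v} v∈ = trans (sym (Vec.lookup-allFin v)) (part-∈⁻ p v∈)

    isolate : ∀ i v → Empty (part p i ∩ N v) ⊎ part p i ⊆ N v
    isolate i v with i ∈? N v
    ... | yes i∈N = inj₂ λ u∈ → subst (_∈ N v) (sym (label u∈)) i∈N
    ... | no  i∉N = inj₁ λ (u , u∈) → let (u∈p , u∈N) = x∈p∩q⁻ (part p i) (N v) u∈ in
                    i∉N (subst (_∈ N v) (label u∈p) u∈N)

  nd-search : ∃ (IsLeast HasModulePartition)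
  nd-search = least hasModulePartition? (order G) singletons

opaque
  nd : Graph → ℕ
  nd G = proj₁ (nd-search G)

  nd-least : ∀ G → IsLeast (HasModulePartition G) (nd G)
  nd-least G = proj₂ (nd-search G)

------------------------------------------------------------------------
-- Random access machines

-- A program uses finitely many registers and finitely many arrays, all
-- holding natural numbers, and every elementary instruction and every
-- test takes one step.  The only arithmetic is increment and decrement,
-- so a number occurring in a run of t steps exceeds the inputs and the
-- program's constants by at most t: unit cost is not an abuse, as words
-- of logarithmic length suffice for a run of polynomial length.

Reg Arr : Set
Reg = ℕ
Arr = ℕ

data Test : Set where
  _≐_ _≺_ : Reg → Reg → Test

infixr 5 _⨾_

data Prog : Set where
  skip       : Prog
  _≔_        : Reg → ℕ → Prog                -- x := n
  _←_        : Reg → Reg → Prog              -- x := y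
  inc dec    : Reg → Prog                    -- x := x + 1,  x := x ∸ 1
  _←_⟨_⟩     : Reg → Arr → Reg → Prog        -- x := a[y]
  _⟨_⟩←_     : Arr → Reg → Reg → Prog        -- a[x] := y
  _⨾_        : Prog → Prog → Prog
  if_⟦_∣_⟧   : Test → Prog → Prog → Prog
  while_⟦_⟧  : Test → Prog → Prog

record State : Set where
  constructor ⟪_,_⟫
  field
    reg : Reg → ℕ
    arr : Arr → ℕ → ℕ

open State

update : {A : Set} → (ℕ → A) → ℕ → A → ℕ → A
update f x a y = if y ≡ᵇ x then a else f y

_[_≔ʳ_] : State → Reg → ℕ → State
σ [ x ≔ʳ n ] = ⟪ update (reg σ) x n , arr σ ⟫

_[_,_≔ᵃ_] : State → Arr → ℕ → ℕ → State
σ [ a , i ≔ᵃ n ] = ⟪ reg σ , update (arr σ) a (update (arr σ a) i n) ⟫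

test : Test → State → Bool
test (x ≐ y) σ = reg σ x ≡ᵇ reg σ y
test (x ≺ y) σ = reg σ x <ᵇ reg σ y

-- ⟨ P , σ ⟩⇓[ t ] τ : started in σ, P halts in τ after t steps.

data ⟨_,_⟩⇓[_]_ : Prog → State → ℕ → State → Set where
  ⇓skip  : ∀ {σ} → ⟨ skip , σ ⟩⇓[ 1 ] σ
  ⇓const : ∀ {σ x n} → ⟨ x ≔ n , σ ⟩⇓[ 1 ] (σ [ x ≔ʳ n ])
  ⇓copy  : ∀ {σ x y} → ⟨ x ← y , σ ⟩⇓[ 1 ] (σ [ x ≔ʳ reg σ y ])
  ⇓inc   : ∀ {σ x} → ⟨ inc x , σ ⟩⇓[ 1 ] (σ [ x ≔ʳ suc (reg σ x) ])
  ⇓dec   : ∀ {σ x} → ⟨ dec x , σ ⟩⇓[ 1 ] (σ [ x ≔ʳ pred (reg σ x) ])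
  ⇓load  : ∀ {σ x a y} → ⟨ x ← a ⟨ y ⟩ , σ ⟩⇓[ 1 ] (σ [ x ≔ʳ arr σ a (reg σ y) ])
  ⇓store : ∀ {σ a x y} → ⟨ a ⟨ x ⟩← y , σ ⟩⇓[ 1 ] (σ [ a , reg σ x ≔ᵃ reg σ y ])
  ⇓seq   : ∀ {P Q σ ρ τ s t} →
           ⟨ P , σ ⟩⇓[ s ] ρ → ⟨ Q , ρ ⟩⇓[ t ] τ → ⟨ P ⨾ Q , σ ⟩⇓[ s + t ] τ
  ⇓then  : ∀ {b P Q σ τ t} → test b σ ≡ true →
           ⟨ P , σ ⟩⇓[ t ] τ → ⟨ if b ⟦ P ∣ Q ⟧ , σ ⟩⇓[ 1 + t ] τ
  ⇓else  : ∀ {b P Q σ τ t} → test b σ ≡ false →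
           ⟨ Q , σ ⟩⇓[ t ] τ → ⟨ if b ⟦ P ∣ Q ⟧ , σ ⟩⇓[ 1 + t ] τ
  ⇓loop  : ∀ {b P σ ρ τ s t} → test b σ ≡ true →
           ⟨ P , σ ⟩⇓[ s ] ρ → ⟨ while b ⟦ P ⟧ , ρ ⟩⇓[ t ] τ →
           ⟨ while b ⟦ P ⟧ , σ ⟩⇓[ 1 + (s + t) ] τ
  ⇓exit  : ∀ {b P σ} → test b σ ≡ false → ⟨ while b ⟦ P ⟧ , σ ⟩⇓[ 1 ] σ

-- The input is in array 0; everything else is initially zero.

_‼_ : List ℕ → ℕ → ℕ
[]       ‼ _     = 0
(x ∷ xs) ‼ zero  = x
(x ∷ xs) ‼ suc i = xs ‼ i

initial : List ℕ → State
initial xs = ⟪ (λ _ → 0) , (λ { zero i → xs ‼ i ; (suc _) _ → 0 }) ⟫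

-- The output is an initial segment of array 1.  Its length need not be
-- recorded, since the graph encoding below is self-delimiting.

HasOutput : State → List ℕ → Set
HasOutput σ ys = map (arr σ 1) (upTo (length ys)) ≡ ys

_on_yields_within_ : Prog → List ℕ → List ℕ → ℕ → Set
P on xs yields ys within T =
  ∃[ t ] ∃[ τ ] (t ≤ T × ⟨ P , initial xs ⟩⇓[ t ] τ × HasOutput τ ys)

-- Adjacency lists, in arbitrary order: the number of vertices followed,
-- for each vertex in turn, by its degree and its neighbours.

_Encodes_ : List ℕ → Graph → Set
xs Encodes G = ∃ λ (nbrs : Fin (order G) → List (Fin (order G))) →
  (∀ v → Unique (nbrs v)) ×
  (∀ v w → w List.∈ nbrs v ⇔ Graph.Adj G v w) ×
  xs ≡ order G ∷ concatMap (λ v → length (nbrs v) ∷ map toℕ (nbrs v)) (allFin (order G))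

_Computes_Within_ : Prog → (Graph → Graph → Set) → (Graph → ℕ) → Set₁
P Computes R Within T = ∀ G xs → xs Encodes G →
  ∃[ H ] ∃[ ys ] (R G H × ys Encodes H × P on xs yields ys within T G)

-- The summand c accounts for the empty graph, whose size is 0.
_ComputesInLinearTime_ : Prog → (Graph → Graph → Set) → Set₁
P ComputesInLinearTime R = ∃[ c ] (P Computes R Within λ G → c * size G + c)

-- Every polynomial is bounded by one of the form c * x ^ d + c.
_ComputesInPolynomialTime_ : Prog → (Graph → Graph → Set) → Set₁
P ComputesInPolynomialTime R = ∃[ c ] ∃[ d ] (P Computes R Within λ G → c * size G ^ d + c)

-- Polynomial kernelization of a graph problem Q parameterized by κ.
_IsPolynomialKernelizationOf_By_ : Prog → (Graph → Set) → (Graph → ℕ) → Set₁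
P IsPolynomialKernelizationOf Q By κ = ∃[ c ] ∃[ d ]
  (P ComputesInPolynomialTime λ G H →
    (Q G ⇔ Q H) × size H + κ H ≤ c * κ G ^ d + c)

{-# OPTIONS --safe #-}
module Submission where

-- Only one vertex of a set of mutual true twins (N[u] = N[v]) matters, as choosing any of them
-- removes all of them.  Choosing one of at least three mutual false twins (N(u) = N(v)) isolates
-- the others, and two isolated vertices cancel; so a pair of them can be deleted as long as a third
-- remains.  Each part of a module partition consists of true twins or of false twins, and therefore
-- keeps at most two vertices.
--
-- Twin classes are computed by partition refinement.  Processing the neighbourhood of u moves the
-- members of each class that it meets to a fresh class, recorded under a stamp peculiar to u; classes
-- that become empty do no harm, so every arc costs constant time.

open import Data.Bool.Base as Bool using (Bool; true; false; _∨_; if_then_else_)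
open import Data.Bool.Properties using (∨-conicalˡ; ∨-conicalʳ)
open import Data.Empty using (⊥; ⊥-elim)
open import Data.Fin.Base using (Fin; toℕ)
import Data.Fin.Properties as Fin
open import Data.Fin.Subset using (Subset; _∈_; _∉_; _⊂_; _─_; ⁅_⁆; ⊤)
open import Data.Fin.Subset.Induction using (⊂-wellFounded)
open import Data.Fin.Subset.Properties
  using (_∈?_; ⊆-antisym; ∈⊤; x∈p∧x∉q⇒x∈p─q; p─q⊆p; x∈p∪q⁺; x∈p∪q⁻; x∈⁅x⁆; x∈⁅y⁆⇒x≡y;
         p∩q≢∅⇒p─q⊂p; x∈p∩q⁺; ⊂-trans)
open import Data.List.Base
  using (List; []; _∷_; [_]; _++_; _ʳ++_; map; concat; concatMap; cartesianProduct; filter; length;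
         allFin; applyUpTo; upTo; tabulate; lookup)
open import Data.List.Membership.DecPropositional using () renaming (_∈?_ to member?)
import Data.List.Membership.Propositional as List
open import Data.List.Membership.Propositional.Properties
  using (∈-map⁺; ∈-map⁻; ∈-filter⁺; ∈-filter⁻; ∈-allFin; ∈-lookup; ∈-∃++; ∈-++⁺ˡ; ∈-++⁺ʳ; ∈-++⁻;
         ∈-cartesianProduct⁺; ∈-concatMap⁻)
open import Data.List.Properties
  using (++-assoc; ++-identityʳ; length-map; length-++; length-filter; length-tabulate;
         concatMap-cong; map-cong; map-∘; map-tabulate; map-upTo; tabulate-lookup;
         filter-accept; filter-reject)
open import Data.List.Relation.Binary.Disjoint.Propositional using (Disjoint)
open import Data.List.Relation.Unary.All as All using (All; []; _∷_)
import Data.List.Relation.Unary.All.Properties as All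
open import Data.List.Relation.Unary.AllPairs as AllPairs using ([]; _∷_)
import Data.List.Relation.Unary.AllPairs.Properties as AllPairs
open import Data.List.Relation.Unary.Any using (here; there; index)
open import Data.List.Relation.Unary.Any.Properties using (lookup-index)
open import Data.List.Relation.Unary.Unique.Propositional using (Unique)
import Data.List.Relation.Unary.Unique.Propositional.Properties as Unique
open import Data.Nat.Base
  using (ℕ; zero; suc; pred; _+_; _*_; _^_; _≤_; _<_; _≡ᵇ_; _<ᵇ_; z≤n; s≤s)
open import Data.Nat.ListAction using (sum)
open import Data.Nat.Properties
open import Data.Nat.Solver using (module +-*-Solver)
open import Data.Product using (∃; ∃-syntax; _×_; _,_; proj₁; proj₂; swap)
import Data.Product.Properties as Product
open import Data.Sum.Base using (_⊎_; inj₁; inj₂; [_,_]′)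
open import Data.Unit.Base using (tt)
import Data.Vec.Base as Vec
import Data.Vec.Properties as Vec
open import Function.Base using (_∘_; id)
open import Function.Bundles using (_⇔_; mk⇔; module Equivalence)
open import Induction.WellFounded using (Acc; acc)
open import Relation.Binary.PropositionalEquality
  using (_≡_; _≢_; refl; sym; trans; cong; cong₂; subst)
open import Relation.Nullary using (Dec; yes; no; does; ¬_; ¬?; contradiction; _×-dec_)
open import Relation.Nullary.Decidable using (dec-true; decidable-stable)
import Relation.Unary as U
open import Defs

open Equivalence using (to; from)
open State

-- Nimbers

-- Both twin relations are taken in the input graph `G`, never in a reduced one: twins of `G` behave
-- as twins in every position `G[S]`, so the removal lemmas apply to any set of survivors. Hence
-- both refinements can read the unchanged input, an array of dead vertices is the only record of
-- the reduction, and the survivors are compared directly with a minimum module partition of `G`.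
-- The second deletion pass revives nobody, so it cannot bring back true twins.
--
-- The obstacle on the game side is that an isolated pair adds an option with no counterpart in the
-- smaller position. The comparison criterion `nim-unique` therefore admits extra options, provided
-- that their values differ from the nimber.
--
-- Linear time leaves no room for clearing arrays between vertices. Stamps only grow and fresh
-- classes are never reused, not even by the second refinement, so stale entries are harmless. All
-- costs are charged to the sum of 1 + degree over the vertices.

module _ {n} {P : Fin n → Set} (P? : U.Decidable P) where

  ⟦_⟧ : Subset n
  ⟦_⟧ = Vec.tabulate (does ∘ P?)

  ∈-⟦⟧⁺ : ∀ {v} → P v → v ∈ ⟦_⟧
  ∈-⟦⟧⁺ {v} p = Vec.lookup⇒[]= v _ (trans (Vec.lookup∘tabulate _ v) (dec-true (P? v) p))

  ∈-⟦⟧⁻ : ∀ {v} → v ∈ ⟦_⟧ → P v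
  ∈-⟦⟧⁻ {v} v∈ with P? v | trans (sym (Vec.lookup∘tabulate (does ∘ P?) v)) (Vec.[]=⇒lookup v∈)
  ... | yes p | _ = p
  ... | no _  | ()

⇔-trans : {A B C : Set} → A ⇔ B → B ⇔ C → A ⇔ C
⇔-trans p q = mk⇔ (to q ∘ to p) (from p ∘ from q)

⇔-sym : {A B : Set} → A ⇔ B → B ⇔ A
⇔-sym p = mk⇔ (from p) (to p)

ext : ∀ {n} {S T : Subset n} → (∀ x → x ∈ S ⇔ x ∈ T) → S ≡ T
ext S⇔T = ⊆-antisym (to (S⇔T _)) (from (S⇔T _))

module _ (G : Graph) where
  open Graph G

  Option : Subset order → ℕ → Set
  Option S k = ∃[ v ] (v ∈ S × nimOn G (S ─ N[ v ]) ≡ k)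

  private
    options : Subset order → List ℕ
    options S = map (λ v → nimOn G (S ─ N[ v ])) (filter (_∈? S) (allFin order))

    option⁺ : ∀ {S k} → Option S k → k List.∈ options S
    option⁺ {S} (v , v∈S , refl) = ∈-map⁺ _ (∈-filter⁺ (_∈? S) (∈-allFin v) v∈S)

    option⁻ : ∀ {S k} → k List.∈ options S → Option S k
    option⁻ {S} k∈ with ∈-map⁻ _ k∈
    ... | v , v∈ , eq = v , proj₂ (∈-filter⁻ (_∈? S) {xs = allFin order} v∈) , sym eq

    least-option : ∀ S → IsLeast (λ k → k List.∉ options S) (nimOn G S)
    least-option S = subst (IsLeast _) (sym (nimOn-unfold G S)) (mex-least (options S))

  nim∉Option : ∀ {S k} → Option S k → k ≢ nimOn G S
  nim∉Option {S} o refl = proj₁ (least-option S) (option⁺ o)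

  <nim⇒Option : ∀ {S k} → k < nimOn G S → Option S k
  <nim⇒Option {S} {k} k<nim = option⁻ (decidable-stable (member? _≟_ k (options S))
    λ k∉ → <⇒≱ k<nim (proj₂ (least-option S) k k∉))

  move⊂ : ∀ {S v} → v ∈ S → S ─ N[ v ] ⊂ S
  move⊂ {S} {v} v∈S = p∩q≢∅⇒p─q⊂p S N[ v ] (v , x∈p∩q⁺ (v∈S , x∈p∪q⁺ (inj₂ (x∈⁅x⁆ v))))

  ∈-move⁺ : ∀ {S v x} → x ∈ S → ¬ Adj v x → x ≢ v → x ∈ S ─ N[ v ]
  ∈-move⁺ {S} {v} x∈S ¬vx x≢v = x∈p∧x∉q⇒x∈p─q x∈S λ x∈N →
    [ ¬vx ∘ ∈-⟦⟧⁻ (adj? v) , x≢v ∘ x∈⁅y⁆⇒x≡y v ]′ (x∈p∪q⁻ (N v) ⁅ v ⁆ x∈N)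

  private
    ∉-─ : ∀ {n} (p q : Subset n) {x} → x ∈ p ─ q → x ∉ q
    ∉-─ (_ Vec.∷ p) (_ Vec.∷ q) (Vec.there x∈) (Vec.there x∈q) = ∉-─ p q x∈ x∈q
    ∉-─ (false Vec.∷ p) (true Vec.∷ q) () Vec.here
    ∉-─ (true Vec.∷ p) (true Vec.∷ q) () Vec.here

  ∈-move⁻ : ∀ {S v x} → x ∈ S ─ N[ v ] → x ∈ S × ¬ Adj v x × x ≢ v
  ∈-move⁻ {S} {v} x∈ =
      p─q⊆p S N[ v ] x∈
    , (λ vx → ∉-─ S N[ v ] x∈ (x∈p∪q⁺ (inj₁ (∈-⟦⟧⁺ (adj? v) vx))))
    , λ { refl → ∉-─ S N[ v ] x∈ (x∈p∪q⁺ (inj₂ (x∈⁅x⁆ v))) }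

-- A mex is unchanged when values other than itself are added to the set. This is why the second
-- hypothesis is weaker than the converse of the first: an extra option of `S′` only has to avoid
-- the nimber of `S`.
nim-unique : ∀ G {S} G′ {S′} →
  (∀ {k} → Option G S k → Option G′ S′ k) →
  (∀ {k} → Option G′ S′ k → Option G S k ⊎ k ≢ nimOn G S) →
  nimOn G S ≡ nimOn G′ S′
nim-unique G {S} G′ {S′} S⇒S′ S′⇒S = ≤-antisym
  (≮⇒≥ λ lt → nim∉Option G′ (S⇒S′ (<nim⇒Option G lt)) refl)
  (≮⇒≥ λ lt → [ (λ o → nim∉Option G o refl) , (λ ne → ne refl) ]′ (S′⇒S (<nim⇒Option G′ lt)))

module _ (G : Graph) where

  -- Recursion on the strategy: if `S` had nimber 0, the position after `v` would have a positive
  -- nimber, hence a reply `w` of value 0, and the strategy would win from there as well.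
  Wins⇒nim≢0 : ∀ {S} → Wins G S → nimOn G S ≢ 0
  Wins⇒nim≢0 {S} (choose v v∈S replies) nim≡0
    with <nim⇒Option G (n≢0⇒n>0 λ eq → nim∉Option G (v , v∈S , eq) (sym nim≡0))
  ... | w , w∈ , eq = Wins⇒nim≢0 (replies w w∈) eq

  nim≢0⇒Wins : ∀ {S} → nimOn G S ≢ 0 → Wins G S
  nim≢0⇒Wins {S} = go S (⊂-wellFounded S)
    where
    go : ∀ S → Acc _⊂_ S → nimOn G S ≢ 0 → Wins G S
    go S (acc rec) nim≢0 with <nim⇒Option G (n≢0⇒n>0 nim≢0)
    ... | v , v∈S , eq = choose v v∈S λ w w∈ →
      go _ (rec (⊂-trans (move⊂ G w∈) (move⊂ G v∈S)))
         (λ eq′ → nim∉Option G (w , w∈ , eq′) (sym eq))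

NodeKayles-cong : ∀ {G H} → nim G ≡ nim H → NodeKayles G ⇔ NodeKayles H
NodeKayles-cong {G} {H} eq = mk⇔
  (λ wins → nim≢0⇒Wins H (Wins⇒nim≢0 G wins ∘ trans eq))
  (λ wins → nim≢0⇒Wins G (Wins⇒nim≢0 H wins ∘ trans (sym eq)))

-- Removing twins

module _ (G : Graph) where
  open Graph G

  FalseTwins TrueTwins : Fin order → Fin order → Set
  FalseTwins a b = ∀ w → Adj w a ⇔ Adj w b
  TrueTwins  a b = ∀ w → (a ≡ w ⊎ Adj w a) ⇔ (b ≡ w ⊎ Adj w b)

  -- The pair is a game of value 0 added to `S′`. A move outside the pair is matched by induction; a
  -- move in the pair can be answered by the other vertex, so its value differs from that of `S′`.
  -- Describing `S′` by its members lets the induction apply to positions reached along different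
  -- routes.
  isolated-pair : ∀ S S′ {a b} → a ≢ b → a ∈ S → b ∈ S →
    (∀ {x} → x ∈ S → ¬ Adj x a × ¬ Adj x b) →
    (∀ x → x ∈ S′ ⇔ (x ∈ S × x ≢ a × x ≢ b)) →
    nimOn G S′ ≡ nimOn G S
  isolated-pair S = go S (⊂-wellFounded S)
    where
    go : ∀ S → Acc _⊂_ S → ∀ S′ {a b} → a ≢ b → a ∈ S → b ∈ S →
      (∀ {x} → x ∈ S → ¬ Adj x a × ¬ Adj x b) →
      (∀ x → x ∈ S′ ⇔ (x ∈ S × x ≢ a × x ≢ b)) →
      nimOn G S′ ≡ nimOn G S
    go S (acc rec) S′ {a} {b} a≢b a∈S b∈S isolated S′⇔ = nim-unique G G smaller larger
      where
      other : ∀ {v} → v ∈ S → v ≢ a → v ≢ b → nimOn G (S′ ─ N[ v ]) ≡ nimOn G (S ─ N[ v ])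
      other {v} v∈S v≢a v≢b = go _ (rec (move⊂ G v∈S)) _ a≢b
        (∈-move⁺ G a∈S (proj₁ (isolated v∈S)) (v≢a ∘ sym))
        (∈-move⁺ G b∈S (proj₂ (isolated v∈S)) (v≢b ∘ sym))
        (λ x∈ → isolated (proj₁ (∈-move⁻ G x∈)))
        λ x → mk⇔
          (λ x∈ → let (x∈S′ , ¬vx , x≢v) = ∈-move⁻ G x∈ ; (x∈S , x≢a , x≢b) = to (S′⇔ x) x∈S′ in
                  ∈-move⁺ G x∈S ¬vx x≢v , x≢a , x≢b)
          (λ (x∈ , x≢a , x≢b) → let (x∈S , ¬vx , x≢v) = ∈-move⁻ G x∈ in
                  ∈-move⁺ G (from (S′⇔ x) (x∈S , x≢a , x≢b)) ¬vx x≢v)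

      smaller : ∀ {k} → Option G S′ k → Option G S k
      smaller (v , v∈S′ , eq) = let (v∈S , v≢a , v≢b) = to (S′⇔ v) v∈S′ in
        v , v∈S , trans (sym (other v∈S v≢a v≢b)) eq

      -- After choosing one of the two vertices, the other one leads to S′.
      avoid : ∀ {c d} → c ∈ S → d ∈ S → d ≢ c → (∀ {x} → x ∈ S → ¬ Adj c x × ¬ Adj d x) →
              (∀ x → x ∈ S′ ⇔ (x ∈ S × x ≢ c × x ≢ d)) →
              nimOn G (S ─ N[ c ]) ≢ nimOn G S′
      avoid {c} {d} c∈S d∈S d≢c iso S′⇔cd eq = nim∉Option G
        (d , ∈-move⁺ G d∈S (proj₁ (iso d∈S)) d≢c , cong (nimOn G) (ext λ x → mk⇔
          (λ x∈ → let (x∈′ , _ , x≢d) = ∈-move⁻ G x∈ ; (x∈S , _ , x≢c) = ∈-move⁻ G x∈′ in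
                  from (S′⇔cd x) (x∈S , x≢c , x≢d))
          (λ x∈S′ → let (x∈S , x≢c , x≢d) = to (S′⇔cd x) x∈S′ in
                  ∈-move⁺ G (∈-move⁺ G x∈S (proj₁ (iso x∈S)) x≢c) (proj₂ (iso x∈S)) x≢d)))
        (sym eq)

      larger : ∀ {k} → Option G S k → Option G S′ k ⊎ k ≢ nimOn G S′
      larger (v , v∈S , refl) with v Fin.≟ a | v Fin.≟ b
      ... | yes refl | _ = inj₂ (avoid a∈S b∈S (a≢b ∘ sym)
              (λ x∈S → proj₁ (isolated x∈S) ∘ symm , proj₂ (isolated x∈S) ∘ symm) S′⇔)
      ... | no _ | yes refl = inj₂ (avoid b∈S a∈S a≢b
              (λ x∈S → proj₂ (isolated x∈S) ∘ symm , proj₁ (isolated x∈S) ∘ symm)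
              λ x → mk⇔ (λ x∈ → let (p , q , r) = to (S′⇔ x) x∈ in p , r , q)
                        (λ (p , q , r) → from (S′⇔ x) (p , r , q)))
      ... | no v≢a | no v≢b = inj₁ (v , from (S′⇔ v) (v∈S , v≢a , v≢b) , other v∈S v≢a v≢b)

  -- The remaining twin `c` stands in for the deleted pair: a move at any of the three removes their
  -- common neighbourhood, and once the two isolated twins cancel, all three moves have the value of
  -- the move at `c` in `S′`. A move at a common neighbour removes all three, and every other move
  -- keeps all three, where induction applies.
  remove-falseTwins : ∀ S S′ {a b c} → a ≢ b → a ≢ c → b ≢ c → a ∈ S → b ∈ S → c ∈ S →
    FalseTwins c a → FalseTwins c b →
    (∀ x → x ∈ S′ ⇔ (x ∈ S × x ≢ a × x ≢ b)) →
    nimOn G S′ ≡ nimOn G S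
  remove-falseTwins S = go S (⊂-wellFounded S)
    where
    go : ∀ S → Acc _⊂_ S → ∀ S′ {a b c} → a ≢ b → a ≢ c → b ≢ c → a ∈ S → b ∈ S → c ∈ S →
      FalseTwins c a → FalseTwins c b →
      (∀ x → x ∈ S′ ⇔ (x ∈ S × x ≢ a × x ≢ b)) →
      nimOn G S′ ≡ nimOn G S
    go S (acc rec) S′ {a} {b} {c} a≢b a≢c b≢c a∈S b∈S c∈S ca cb S′⇔ =
      nim-unique G G smaller larger
      where
      c∈S′ : c ∈ S′
      c∈S′ = from (S′⇔ c) (c∈S , a≢c ∘ sym , b≢c ∘ sym)

      -- Choosing any of the three twins isolates the other two.
      isolating : ∀ {d e f} → d ∈ S → e ∈ S → f ∈ S → e ≢ d → f ≢ d → e ≢ f →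
        FalseTwins c d → FalseTwins c e → FalseTwins c f →
        (∀ x → (x ≢ d × x ≢ e × x ≢ f) ⇔ (x ≢ c × x ≢ a × x ≢ b)) →
        nimOn G (S′ ─ N[ c ]) ≡ nimOn G (S ─ N[ d ])
      isolating {d} {e} {f} d∈S e∈S f∈S e≢d f≢d e≢f cd ce cf same =
        isolated-pair (S ─ N[ d ]) _ e≢f
          (∈-move⁺ G e∈S (λ de → irrefl refl (to (cd _) (from (ce _) de))) e≢d)
          (∈-move⁺ G f∈S (λ df → irrefl refl (to (cd _) (from (cf _) df))) f≢d)
          (λ x∈ → let (_ , ¬dx , _) = ∈-move⁻ G x∈ in
              (λ xe → ¬dx (symm (to (cd _) (from (ce _) xe))))
            , (λ xf → ¬dx (symm (to (cd _) (from (cf _) xf)))))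
          λ x → mk⇔
            (λ x∈ → let (x∈S′ , ¬cx , x≢c) = ∈-move⁻ G x∈
                        (x∈S , x≢a , x≢b) = to (S′⇔ x) x∈S′
                        (x≢d , x≢e , x≢f) = from (same x) (x≢c , x≢a , x≢b) in
                    ∈-move⁺ G x∈S (λ dx → ¬cx (symm (from (cd _) (symm dx)))) x≢d , x≢e , x≢f)
            (λ (x∈ , x≢e , x≢f) →
                let (x∈S , ¬dx , x≢d) = ∈-move⁻ G x∈
                    (x≢c , x≢a , x≢b) = to (same x) (x≢d , x≢e , x≢f) in
                ∈-move⁺ G (from (S′⇔ x) (x∈S , x≢a , x≢b))
                        (λ cx → ¬dx (symm (to (cd _) (symm cx)))) x≢c)

      twin-c : nimOn G (S′ ─ N[ c ]) ≡ nimOn G (S ─ N[ c ])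
      twin-c = isolating c∈S a∈S b∈S a≢c b≢c a≢b (λ _ → mk⇔ id id) ca cb (λ _ → mk⇔ id id)

      other : ∀ {v} → v ∈ S → v ≢ a → v ≢ b → nimOn G (S′ ─ N[ v ]) ≡ nimOn G (S ─ N[ v ])
      other {v} v∈S v≢a v≢b with v Fin.≟ c | adj? v c
      ... | yes refl | _ = twin-c
      ... | no v≢c | no ¬vc = go _ (rec (move⊂ G v∈S)) _ a≢b a≢c b≢c
              (∈-move⁺ G a∈S (¬vc ∘ from (ca v)) (v≢a ∘ sym))
              (∈-move⁺ G b∈S (¬vc ∘ from (cb v)) (v≢b ∘ sym))
              (∈-move⁺ G c∈S ¬vc (v≢c ∘ sym)) ca cb
              λ x → mk⇔
                (λ x∈ → let (x∈S′ , ¬vx , x≢v) = ∈-move⁻ G x∈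
                            (x∈S , x≢a , x≢b) = to (S′⇔ x) x∈S′ in
                        ∈-move⁺ G x∈S ¬vx x≢v , x≢a , x≢b)
                (λ (x∈ , x≢a , x≢b) → let (x∈S , ¬vx , x≢v) = ∈-move⁻ G x∈ in
                        ∈-move⁺ G (from (S′⇔ x) (x∈S , x≢a , x≢b)) ¬vx x≢v)
      ... | no v≢c | yes vc = cong (nimOn G) (ext λ x → mk⇔
              (λ x∈ → let (x∈S′ , ¬vx , x≢v) = ∈-move⁻ G x∈
                          (x∈S , x≢a , x≢b) = to (S′⇔ x) x∈S′ in
                      ∈-move⁺ G x∈S ¬vx x≢v)
              (λ x∈ → let (x∈S , ¬vx , x≢v) = ∈-move⁻ G x∈ in
                      ∈-move⁺ G (from (S′⇔ x) (x∈S
                        , (λ { refl → ¬vx (to (ca v) vc) })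
                        , (λ { refl → ¬vx (to (cb v) vc) }))) ¬vx x≢v))

      smaller : ∀ {k} → Option G S′ k → Option G S k
      smaller (v , v∈S′ , eq) = let (v∈S , v≢a , v≢b) = to (S′⇔ v) v∈S′ in
        v , v∈S , trans (sym (other v∈S v≢a v≢b)) eq

      larger : ∀ {k} → Option G S k → Option G S′ k ⊎ k ≢ nimOn G S′
      larger (v , v∈S , eq) with v Fin.≟ a | v Fin.≟ b
      ... | yes refl | _ = inj₁ (c , c∈S′ , trans
              (isolating a∈S b∈S c∈S (a≢b ∘ sym) (a≢c ∘ sym) b≢c ca cb (λ _ → mk⇔ id id)
                (λ x → mk⇔ (λ (p , q , r) → r , p , q) (λ (p , q , r) → q , r , p))) eq)
      ... | no _ | yes refl = inj₁ (c , c∈S′ , trans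
              (isolating b∈S a∈S c∈S a≢b (b≢c ∘ sym) a≢c cb ca (λ _ → mk⇔ id id)
                (λ x → mk⇔ (λ (p , q , r) → r , q , p) (λ (p , q , r) → r , q , p))) eq)
      ... | no v≢a | no v≢b = inj₁ (v , from (S′⇔ v) (v∈S , v≢a , v≢b)
              , trans (other v∈S v≢a v≢b) eq)

  -- The lost move at `b` reaches the same set of vertices as the move at `a` in `S′`. Any other
  -- move either removes `b`, so that the two positions coincide, or keeps both twins, where
  -- induction applies.
  remove-trueTwin : ∀ S S′ {a b} → a ≢ b → a ∈ S → b ∈ S → TrueTwins a b →
    (∀ x → x ∈ S′ ⇔ (x ∈ S × x ≢ b)) →
    nimOn G S′ ≡ nimOn G S
  remove-trueTwin S = go S (⊂-wellFounded S)
    where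
    go : ∀ S → Acc _⊂_ S → ∀ S′ {a b} → a ≢ b → a ∈ S → b ∈ S → TrueTwins a b →
      (∀ x → x ∈ S′ ⇔ (x ∈ S × x ≢ b)) →
      nimOn G S′ ≡ nimOn G S
    go S (acc rec) S′ {a} {b} a≢b a∈S b∈S twins S′⇔ = nim-unique G G smaller larger
      where
      a~b : Adj a b
      a~b = [ (λ eq → contradiction (sym eq) a≢b) , id ]′ (to (twins a) (inj₁ refl))

      other : ∀ {v} → v ∈ S → v ≢ b → nimOn G (S′ ─ N[ v ]) ≡ nimOn G (S ─ N[ v ])
      other {v} v∈S v≢b with v Fin.≟ a | adj? v b
      ... | no v≢a | no ¬vb = go _ (rec (move⊂ G v∈S)) _ a≢b
              (∈-move⁺ G a∈S (λ va → [ v≢b ∘ sym , ¬vb ]′ (to (twins v) (inj₂ va))) (v≢a ∘ sym))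
              (∈-move⁺ G b∈S ¬vb (v≢b ∘ sym)) twins
              λ x → mk⇔
                (λ x∈ → let (x∈S′ , ¬vx , x≢v) = ∈-move⁻ G x∈ ; (x∈S , x≢b) = to (S′⇔ x) x∈S′ in
                        ∈-move⁺ G x∈S ¬vx x≢v , x≢b)
                (λ (x∈ , x≢b) → let (x∈S , ¬vx , x≢v) = ∈-move⁻ G x∈ in
                        ∈-move⁺ G (from (S′⇔ x) (x∈S , x≢b)) ¬vx x≢v)
      ... | yes refl | no ¬vb = contradiction a~b ¬vb
      ... | _ | yes vb = cong (nimOn G) (ext λ x → mk⇔
              (λ x∈ → let (x∈S′ , ¬vx , x≢v) = ∈-move⁻ G x∈ ; (x∈S , x≢b) = to (S′⇔ x) x∈S′ in
                      ∈-move⁺ G x∈S ¬vx x≢v)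
              (λ x∈ → let (x∈S , ¬vx , x≢v) = ∈-move⁻ G x∈ in
                      ∈-move⁺ G (from (S′⇔ x) (x∈S , λ { refl → ¬vx vb })) ¬vx x≢v))

      smaller : ∀ {k} → Option G S′ k → Option G S k
      smaller (v , v∈S′ , eq) = let (v∈S , v≢b) = to (S′⇔ v) v∈S′ in
        v , v∈S , trans (sym (other v∈S v≢b)) eq

      twin-move : nimOn G (S′ ─ N[ a ]) ≡ nimOn G (S ─ N[ b ])
      twin-move = cong (nimOn G) (ext λ x → mk⇔
        (λ x∈ → let (x∈S′ , ¬ax , x≢a) = ∈-move⁻ G x∈ ; (x∈S , x≢b) = to (S′⇔ x) x∈S′ in
                ∈-move⁺ G x∈S
                  (λ bx → [ x≢a ∘ sym , ¬ax ∘ symm ]′ (from (twins x) (inj₂ (symm bx)))) x≢b)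
        (λ x∈ → let (x∈S , ¬bx , x≢b) = ∈-move⁻ G x∈ in
                ∈-move⁺ G (from (S′⇔ x) (x∈S , x≢b))
                  (λ ax → [ x≢b ∘ sym , ¬bx ∘ symm ]′ (to (twins x) (inj₂ (symm ax))))
                  λ { refl → ¬bx (symm a~b) }))

      larger : ∀ {k} → Option G S k → Option G S′ k ⊎ k ≢ nimOn G S′
      larger (v , v∈S , eq) with v Fin.≟ b
      ... | yes refl = inj₁ (a , from (S′⇔ a) (a∈S , a≢b) , trans twin-move eq)
      ... | no v≢b = inj₁ (v , from (S′⇔ v) (v∈S , v≢b) , trans (other v∈S v≢b) eq)

-- Counting in lists

module _ {A : Set} where

  length-filter-split : {P : A → Set} (P? : U.Decidable P) → ∀ xs →
    length xs ≡ length (filter P? xs) + length (filter (¬? ∘ P?) xs)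
  length-filter-split P? [] = refl
  length-filter-split P? (x ∷ xs) with P? x
  ... | yes _ = cong suc (length-filter-split P? xs)
  ... | no  _ = trans (cong suc (length-filter-split P? xs)) (sym (+-suc _ _))

  Unique-⊆⇒length≤ : ∀ {xs ys : List A} → Unique xs → (∀ {x} → x List.∈ xs → x List.∈ ys) →
    length xs ≤ length ys
  Unique-⊆⇒length≤ {[]} _ _ = z≤n
  Unique-⊆⇒length≤ {x ∷ xs} (x∉ ∷ xs!) sub with ∈-∃++ (sub (here refl))
  ... | ys , zs , refl = ≤-trans
    (s≤s (Unique-⊆⇒length≤ xs! sub′))
    (≤-reflexive (trans (cong suc (length-++ ys)) (trans (sym (+-suc _ _)) (sym (length-++ ys)))))
    where
    sub′ : ∀ {y} → y List.∈ xs → y List.∈ ys ++ zs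
    sub′ y∈ with ∈-++⁻ ys (sub (there y∈))
    ... | inj₁ y∈ys = ∈-++⁺ˡ y∈ys
    ... | inj₂ (there y∈zs) = ∈-++⁺ʳ ys y∈zs
    ... | inj₂ (here refl) = contradiction refl (All.lookup x∉ y∈)

  no-triple⇒length≤2 : ∀ {xs : List A} → Unique xs →
    (∀ {x y z} → x List.∈ xs → y List.∈ xs → z List.∈ xs → x ≡ y ⊎ x ≡ z ⊎ y ≡ z) →
    length xs ≤ 2
  no-triple⇒length≤2 {[]} _ _ = z≤n
  no-triple⇒length≤2 {_ ∷ []} _ _ = s≤s z≤n
  no-triple⇒length≤2 {_ ∷ _ ∷ []} _ _ = s≤s (s≤s z≤n)
  no-triple⇒length≤2 {_ ∷ _ ∷ _ ∷ _} ((x≢y ∷ x≢z ∷ _) ∷ (y≢z ∷ _) ∷ _) no-triple =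
    ⊥-elim ([ x≢y , [ x≢z , y≢z ]′ ]′
      (no-triple (here refl) (there (here refl)) (there (there (here refl)))))

  -- Pigeonhole, one label at a time. The admissible labels form an explicit list so that the
  -- recursion can shorten it while `k` stays fixed.
  length≤2*labels : ∀ {k} (f : A → Fin k) (ls : List (Fin k)) {xs : List A} → Unique xs →
    (∀ {x} → x List.∈ xs → f x List.∈ ls) →
    (∀ {x y z} → x List.∈ xs → y List.∈ xs → z List.∈ xs → f x ≡ f y → f x ≡ f z →
      x ≡ y ⊎ x ≡ z ⊎ y ≡ z) →
    length xs ≤ 2 * length ls
  length≤2*labels f [] {[]} _ _ _ = z≤n
  length≤2*labels f [] {x ∷ xs} _ labelled _ with labelled (here refl)
  ... | ()
  length≤2*labels f (l ∷ ls) {xs} xs! labelled no-triple = ≤-trans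
    (≤-reflexive (length-filter-split l? xs))
    (≤-trans
      (+-mono-≤
        (no-triple⇒length≤2 (Unique.filter⁺ l? xs!) λ x∈ y∈ z∈ →
          let (x∈ , fx) = ∈-filter⁻ l? x∈ ; (y∈ , fy) = ∈-filter⁻ l? y∈
              (z∈ , fz) = ∈-filter⁻ l? z∈ in
          no-triple x∈ y∈ z∈ (trans fx (sym fy)) (trans fx (sym fz)))
        (length≤2*labels f ls (Unique.filter⁺ (¬? ∘ l?) xs!) others
          λ x∈ y∈ z∈ → no-triple (proj₁ (∈-filter⁻ (¬? ∘ l?) x∈))
            (proj₁ (∈-filter⁻ (¬? ∘ l?) y∈)) (proj₁ (∈-filter⁻ (¬? ∘ l?) z∈))))
      (≤-reflexive (sym (*-suc 2 (length ls)))))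
    where
    l? : U.Decidable (λ x → f x ≡ l)
    l? x = f x Fin.≟ l

    others : ∀ {x} → x List.∈ filter (¬? ∘ l?) xs → f x List.∈ ls
    others x∈ with ∈-filter⁻ (¬? ∘ l?) x∈
    ... | x∈xs , fx≢l with labelled x∈xs
    ...   | here fx≡l = contradiction fx≡l fx≢l
    ...   | there fx∈ = fx∈

  lookup-injective : ∀ {xs : List A} → Unique xs → ∀ i j → lookup xs i ≡ lookup xs j → i ≡ j
  lookup-injective (_ ∷ _) Fin.zero Fin.zero _ = refl
  lookup-injective {_ ∷ xs} (x∉ ∷ _) Fin.zero (Fin.suc j) eq =
    contradiction eq (All.lookup x∉ (∈-lookup {xs = xs} j))
  lookup-injective {_ ∷ xs} (x∉ ∷ _) (Fin.suc i) Fin.zero eq =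
    contradiction (sym eq) (All.lookup x∉ (∈-lookup {xs = xs} i))
  lookup-injective (_ ∷ xs!) (Fin.suc i) (Fin.suc j) eq = cong Fin.suc (lookup-injective xs! i j eq)

length-cartesianProduct : {A B : Set} (xs : List A) (ys : List B) →
  length (cartesianProduct xs ys) ≡ length xs * length ys
length-cartesianProduct [] ys = refl
length-cartesianProduct (x ∷ xs) ys = trans (length-++ (map (x ,_) ys))
  (cong₂ _+_ (length-map (x ,_) ys) (length-cartesianProduct xs ys))

-- Induced subgraphs

module _ (G : Graph) where
  open Graph G

  length-edges≤ : length edges ≤ order * order
  length-edges≤ = ≤-trans
    (length-filter (λ (u , v) → (u Fin.<? v) ×-dec adj? u v)
                   (cartesianProduct (allFin order) (allFin order)))
    (≤-reflexive
    (trans (length-cartesianProduct (allFin order) (allFin order))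
           (cong₂ _*_ (length-tabulate {n = order} id) (length-tabulate {n = order} id))))

  nd≤order : nd G ≤ order
  nd≤order = proj₂ (nd-least G) order (singletons G)

  module _ (nbrs : Fin order → List (Fin order)) (nbrs! : ∀ v → Unique (nbrs v))
           (nbrs⇔ : ∀ v w → w List.∈ nbrs v ⇔ Adj v w) where

    private
      arcs : List (Fin order × Fin order)
      arcs = concatMap (λ v → map (v ,_) (nbrs v)) (allFin order)

      arcs! : Unique arcs
      arcs! = Unique.concat⁺
        (All.map⁺ (All.universal (λ v → Unique.map⁺ Product.,-injectiveʳ (nbrs! v)) (allFin order)))
        (AllPairs.map⁺ (AllPairs.map
          disjoint
          (Unique.allFin⁺ order)))
        where
        source : ∀ {v e} → e List.∈ map (v ,_) (nbrs v) → proj₁ e ≡ v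
        source e∈ with ∈-map⁻ _ e∈
        ... | _ , _ , refl = refl

        disjoint : ∀ {u v} → u ≢ v → Disjoint (map (u ,_) (nbrs u)) (map (v ,_) (nbrs v))
        disjoint u≢v (e∈u , e∈v) = u≢v (trans (sym (source e∈u)) (source e∈v))

      arcs⁻ : ∀ {u v} → (u , v) List.∈ arcs → Adj u v
      arcs⁻ e∈ with List.find (∈-concatMap⁻ (λ v → map (v ,_) (nbrs v)) {xs = allFin order} e∈)
      ... | u , _ , e∈′ with ∈-map⁻ _ e∈′
      ...   | v , v∈ , refl = to (nbrs⇔ u v) v∈

      ∈-edges : ∀ {u v} → toℕ u < toℕ v → Adj u v → (u , v) List.∈ edges
      ∈-edges u<v uv = ∈-filter⁺ _ (∈-cartesianProduct⁺ (∈-allFin _) (∈-allFin _)) (u<v , uv)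

      up? : U.Decidable (λ (e : Fin order × Fin order) → toℕ (proj₁ e) < toℕ (proj₂ e))
      up? (u , v) = u Fin.<? v

      length-arcs : ∀ vs → length (concatMap (λ v → map (v ,_) (nbrs v)) vs) ≡ sum (map (length ∘ nbrs) vs)
      length-arcs [] = refl
      length-arcs (v ∷ vs) = trans (length-++ (map (v ,_) (nbrs v)))
        (cong₂ _+_ (length-map (v ,_) (nbrs v)) (length-arcs vs))

    -- One half of the handshake lemma. The upward arcs are distinct members of `edges`, and so are
    -- the reversals of the remaining ones.
    sum-degrees≤ : sum (map (length ∘ nbrs) (allFin order)) ≤ length edges + length edges
    sum-degrees≤ = ≤-trans
      (≤-reflexive (trans (sym (length-arcs (allFin order))) (length-filter-split up? arcs)))
      (+-mono-≤
        (Unique-⊆⇒length≤ (Unique.filter⁺ up? arcs!)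
          λ e∈ → let (e∈arcs , u<v) = ∈-filter⁻ up? {xs = arcs} e∈ in ∈-edges u<v (arcs⁻ e∈arcs))
        (≤-trans (≤-reflexive (sym (length-map swap (filter (¬? ∘ up?) arcs))))
          (Unique-⊆⇒length≤
            (Unique.map⁺ (λ { refl → refl }) (Unique.filter⁺ (¬? ∘ up?) arcs!))
            down)))
      where
      down : ∀ {e} → e List.∈ map swap (filter (¬? ∘ up?) arcs) → e List.∈ edges
      down e∈ with ∈-map⁻ swap e∈
      ... | (u , v) , e∈′ , refl =
        let (e∈arcs , u≮v) = ∈-filter⁻ (¬? ∘ up?) {xs = arcs} e∈′ ; uv = arcs⁻ e∈arcs in
        ∈-edges (≤∧≢⇒< (≮⇒≥ u≮v) λ eq → irrefl (sym (Fin.toℕ-injective eq)) uv) (symm uv)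

module Induced (G : Graph) {P : Fin (Graph.order G) → Set} (P? : U.Decidable P) where
  open Graph G

  vertices : List (Fin order)
  vertices = filter P? (allFin order)

  vertices! : Unique vertices
  vertices! = Unique.filter⁺ P? (Unique.allFin⁺ order)

  ∈-vertices⁺ : ∀ {v} → P v → v List.∈ vertices
  ∈-vertices⁺ Pv = ∈-filter⁺ P? (∈-allFin _) Pv

  ∈-vertices⁻ : ∀ {v} → v List.∈ vertices → P v
  ∈-vertices⁻ v∈ = proj₂ (∈-filter⁻ P? {xs = allFin order} v∈)

  private
    emb : Fin (length vertices) → Fin order
    emb = lookup vertices

  induced : Graph
  induced = record
    { order  = length vertices
    ; Adj    = λ i j → Adj (emb i) (emb j)
    ; adj?   = λ i j → adj? (emb i) (emb j)
    ; symm   = symm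
    ; irrefl = λ { refl → irrefl refl }
    }

  private
    emb-injective : ∀ {i j} → emb i ≡ emb j → i ≡ j
    emb-injective = lookup-injective vertices! _ _

  -- Stated for arbitrary corresponding positions, since the correspondence has to survive moves.
  -- The last hypothesis ensures that every move in `S` is available in the induced graph.
  nimOn-induced : ∀ T S → (∀ i → i ∈ T ⇔ emb i ∈ S) → (∀ {v} → v ∈ S → ∃[ i ] emb i ≡ v) →
    nimOn induced T ≡ nimOn G S
  nimOn-induced T = go T (⊂-wellFounded T)
    where
    go : ∀ T → Acc _⊂_ T → ∀ S → (∀ i → i ∈ T ⇔ emb i ∈ S) → (∀ {v} → v ∈ S → ∃[ i ] emb i ≡ v) →
      nimOn induced T ≡ nimOn G S
    go T (acc rec) S T⇔S image = nim-unique induced G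
      (λ (i , i∈T , eq) → emb i , to (T⇔S i) i∈T , trans (sym (same i∈T)) eq)
      larger
      where
      same : ∀ {i} → i ∈ T →
        nimOn induced (T ─ Graph.N[_] induced i) ≡ nimOn G (S ─ N[ emb i ])
      same {i} i∈T = go _ (rec (move⊂ induced i∈T)) _
        (λ j → mk⇔
          (λ j∈ → let (j∈T , ¬ij , j≢i) = ∈-move⁻ induced j∈ in
                  ∈-move⁺ G (to (T⇔S j) j∈T) ¬ij (j≢i ∘ emb-injective))
          (λ j∈ → let (j∈S , ¬ij , j≢i) = ∈-move⁻ G j∈ in
                  ∈-move⁺ induced (from (T⇔S j) j∈S) ¬ij (j≢i ∘ cong emb)))
        (image ∘ proj₁ ∘ ∈-move⁻ G)

      larger : ∀ {k} → Option G S k → Option induced T k ⊎ k ≢ nimOn induced T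
      larger (v , v∈S , eq) with image v∈S
      ... | i , refl = let i∈T = from (T⇔S i) v∈S in inj₁ (i , i∈T , trans (same i∈T) eq)

  nim-induced : nim induced ≡ nimOn G ⟦ P? ⟧
  nim-induced = nimOn-induced ⊤ _
    (λ i → mk⇔ (λ _ → ∈-⟦⟧⁺ P? (∈-vertices⁻ (∈-lookup i))) (λ _ → ∈⊤))
    (λ v∈ → let v∈′ = ∈-vertices⁺ (∈-⟦⟧⁻ P? v∈) in index v∈′ , sym (lookup-index v∈′))

  -- A part of a module partition contains only true twins or only false twins.
  order-induced≤ :
    (∀ {x y} → P x → P y → TrueTwins G x y → x ≡ y) →
    (∀ {x y z} → P x → P y → P z → FalseTwins G x y → FalseTwins G x z → x ≡ y ⊎ x ≡ z ⊎ y ≡ z) →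
    length vertices ≤ 2 * nd G
  order-induced≤ no-trueTwins no-falseTwins with nd G | proj₁ (nd-least G)
  ... | k | p , modules = ≤-trans
    (length≤2*labels label (allFin k) vertices! (λ _ → ∈-allFin _) no-triple)
    (≤-reflexive (cong (2 *_) (length-tabulate {n = k} id)))
    where
    label : Fin order → Fin k
    label = Vec.lookup p

    module _ (i : Fin k) {x y : Fin order} (x∈ : x ∈ part G p i) (y∈ : y ∈ part G p i) where

      outside : ∀ w → w ∉ part G p i → Adj w x → Adj w y
      outside w w∉ wx with proj₁ (proj₂ (modules i)) w w∉
      ... | inj₁ empty = contradiction (x , x∈p∩q⁺ (x∈ , ∈-⟦⟧⁺ (adj? w) wx)) empty
      ... | inj₂ full = ∈-⟦⟧⁻ (adj? w) (full y∈)

    -- Vertices outside the part do not distinguish `x` from `y` by the module property, and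
    -- vertices inside do not by the clique or independence property. Distinctness is what makes the
    -- clique property yield the edge between `x` and `y`.
    twins : ∀ i {x y} → x ∈ part G p i → y ∈ part G p i →
      (x ≢ y → TrueTwins G x y) ⊎ FalseTwins G x y
    twins i {x} {y} x∈ y∈ with proj₂ (proj₂ (modules i))
    ... | inj₂ independent = inj₂ λ w → mk⇔ (half x∈ y∈) (half y∈ x∈)
      where
      half : ∀ {w x y} → x ∈ part G p i → y ∈ part G p i → Adj w x → Adj w y
      half {w} {x} {y} x∈ y∈ wx with w ∈? part G p i
      ... | yes w∈ = contradiction wx (independent w x w∈ x∈)
      ... | no  w∉ = outside i x∈ y∈ w w∉ wx
    ... | inj₁ clique = inj₁ λ x≢y w → mk⇔ (half x∈ y∈ x≢y) (half y∈ x∈ (x≢y ∘ sym))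
      where
      half : ∀ {w x y} → x ∈ part G p i → y ∈ part G p i → x ≢ y → x ≡ w ⊎ Adj w x → y ≡ w ⊎ Adj w y
      half {w} {x} {y} x∈ y∈ x≢y (inj₁ refl) = inj₂ (clique x y x∈ y∈ x≢y)
      half {w} {x} {y} x∈ y∈ x≢y (inj₂ wx) with y Fin.≟ w | w ∈? part G p i
      ... | yes y≡w | _ = inj₁ y≡w
      ... | no y≢w | yes w∈ = inj₂ (clique w y w∈ y∈ (y≢w ∘ sym))
      ... | no y≢w | no w∉ = inj₂ (outside i x∈ y∈ w w∉ wx)

    no-triple : ∀ {x y z} → x List.∈ vertices → y List.∈ vertices → z List.∈ vertices →
      label x ≡ label y → label x ≡ label z → x ≡ y ⊎ x ≡ z ⊎ y ≡ z
    no-triple {x} {y} {z} x∈ y∈ z∈ xy xz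
      with x Fin.≟ y | x Fin.≟ z
         | twins (label x) (part-∈⁺ G p refl) (part-∈⁺ G p (sym xy))
         | twins (label x) (part-∈⁺ G p refl) (part-∈⁺ G p (sym xz))
    ... | yes x≡y | _ | _ | _ = inj₁ x≡y
    ... | no _ | yes x≡z | _ | _ = inj₂ (inj₁ x≡z)
    ... | no x≢y | _ | inj₁ true-xy | _ =
      inj₁ (no-trueTwins (∈-vertices⁻ x∈) (∈-vertices⁻ y∈) (true-xy x≢y))
    ... | _ | no x≢z | _ | inj₁ true-xz =
      inj₂ (inj₁ (no-trueTwins (∈-vertices⁻ x∈) (∈-vertices⁻ z∈) (true-xz x≢z)))
    ... | _ | _ | inj₂ false-xy | inj₂ false-xz =
      no-falseTwins (∈-vertices⁻ x∈) (∈-vertices⁻ y∈) (∈-vertices⁻ z∈) false-xy false-xz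

  module _ (nbrs : Fin order → List (Fin order)) (nbrs! : ∀ v → Unique (nbrs v))
           (nbrs⇔ : ∀ v w → w List.∈ nbrs v ⇔ Adj v w)
           (newId : Fin order → ℕ) (newId-lookup : ∀ i → newId (lookup vertices i) ≡ toℕ i) where

    block : Fin order → List ℕ
    block v = length (filter P? (nbrs v)) ∷ map newId (filter P? (nbrs v))

    private
      -- The neighbour lists of the induced graph keep the order of the input lists, because the
      -- encoding must agree literally with the blocks that the program writes.
      pull : List (Fin order) → List (Fin (length vertices))
      pull [] = []
      pull (w ∷ ws) with P? w
      ... | yes Pw = index (∈-vertices⁺ Pw) ∷ pull ws
      ... | no  _  = pull ws

      emb-pull : ∀ ws → map emb (pull ws) ≡ filter P? ws
      emb-pull [] = refl
      emb-pull (w ∷ ws) with P? w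
      ... | yes Pw = cong₂ _∷_ (sym (lookup-index (∈-vertices⁺ Pw))) (emb-pull ws)
      ... | no  _  = emb-pull ws

      pull! : ∀ {ws} → Unique ws → Unique (pull ws)
      pull! {ws} ws! = Unique.map⁻ (subst Unique (sym (emb-pull ws)) (Unique.filter⁺ P? ws!))

      pull⇔ : ∀ ws i → i List.∈ pull ws ⇔ emb i List.∈ ws
      pull⇔ ws i = mk⇔
        (λ i∈ → proj₁ (∈-filter⁻ P? (subst (emb i List.∈_) (emb-pull ws) (∈-map⁺ emb i∈))))
        (λ e∈ → back (∈-map⁻ emb (subst (emb i List.∈_) (sym (emb-pull ws))
          (∈-filter⁺ P? e∈ (∈-vertices⁻ (∈-lookup i))))))
        where
        back : ∃ (λ j → j List.∈ pull ws × emb i ≡ emb j) → i List.∈ pull ws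
        back (j , j∈ , eq) = subst (List._∈ pull ws) (sym (emb-injective eq)) j∈

      block-pull : ∀ v → length (pull (nbrs v)) ∷ map toℕ (pull (nbrs v)) ≡ block v
      block-pull v = cong₂ _∷_
        (trans (sym (length-map emb (pull (nbrs v)))) (cong length (emb-pull (nbrs v))))
        (trans (map-cong (sym ∘ newId-lookup) (pull (nbrs v)))
          (trans (map-∘ (pull (nbrs v))) (cong (map newId) (emb-pull (nbrs v)))))

    induced-encoding : (length vertices ∷ concatMap block vertices) Encodes induced
    induced-encoding =
        (λ i → pull (nbrs (emb i)))
      , (λ i → pull! (nbrs! (emb i)))
      , (λ i j → ⇔-trans (pull⇔ (nbrs (emb i)) j) (nbrs⇔ (emb i) (emb j)))
      , cong (length vertices ∷_) (sym (trans
          (concatMap-cong (block-pull ∘ emb) (allFin (length vertices)))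
          (cong concat (trans (map-tabulate id (block ∘ emb))
            (trans (sym (map-tabulate emb block)) (cong (map block) (tabulate-lookup vertices)))))))

-- Program verification

≡ᵇ-true : ∀ {m n} → (m ≡ᵇ n) ≡ true → m ≡ n
≡ᵇ-true {m} {n} eq = ≡ᵇ⇒≡ m n (subst Bool.T (sym eq) tt)

≡ᵇ-false : ∀ {m n} → (m ≡ᵇ n) ≡ false → m ≢ n
≡ᵇ-false {zero}  {suc n} _ ()
≡ᵇ-false {suc m} {suc n} eq refl = ≡ᵇ-false {m} eq refl

≡ᵇ-refl : ∀ n → (n ≡ᵇ n) ≡ true
≡ᵇ-refl zero = refl
≡ᵇ-refl (suc n) = ≡ᵇ-refl n

≢⇒≡ᵇ : ∀ {m n} → m ≢ n → (m ≡ᵇ n) ≡ false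
≢⇒≡ᵇ {m} {n} m≢n with m ≡ᵇ n in eq
... | true = contradiction (≡ᵇ-true eq) m≢n
... | false = refl

update-≡ : ∀ {A : Set} (f : ℕ → A) x {a} → update f x a x ≡ a
update-≡ f x rewrite ≡ᵇ-refl x = refl

update-≢ : ∀ {A : Set} (f : ℕ → A) {x a y} → y ≢ x → update f x a y ≡ f y
update-≢ f y≢x rewrite ≢⇒≡ᵇ y≢x = refl

<ᵇ-true : ∀ {m n} → m < n → (m <ᵇ n) ≡ true
<ᵇ-true {zero}  (s≤s _) = refl
<ᵇ-true {suc m} (s≤s m<n) = <ᵇ-true m<n

<ᵇ-false : ∀ n → (n <ᵇ n) ≡ false
<ᵇ-false zero = refl
<ᵇ-false (suc n) = <ᵇ-false n

record Terminates (P : Prog) (σ : State) (T : ℕ) (Φ : State → Set) : Set where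
  constructor halts
  field
    {time}   : ℕ
    {final}  : State
    time≤    : time ≤ T
    run      : ⟨ P , σ ⟩⇓[ time ] final
    post     : Φ final

-- Syntactic footprints with Boolean values: for a concrete program and a concrete array or
-- register, a frame condition is proved by `refl`.
stores : Prog → Arr → Bool
stores (b ⟨ _ ⟩← _) a = a ≡ᵇ b
stores (P ⨾ Q) a = stores P a ∨ stores Q a
stores if _ ⟦ P ∣ Q ⟧ a = stores P a ∨ stores Q a
stores while _ ⟦ P ⟧ a = stores P a
stores _ _ = false

assigns : Prog → Reg → Bool
assigns (y ≔ _) x = x ≡ᵇ y
assigns (y ← _) x = x ≡ᵇ y
assigns (inc y) x = x ≡ᵇ y
assigns (dec y) x = x ≡ᵇ y
assigns (y ← _ ⟨ _ ⟩) x = x ≡ᵇ y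
assigns (P ⨾ Q) x = assigns P x ∨ assigns Q x
assigns if _ ⟦ P ∣ Q ⟧ x = assigns P x ∨ assigns Q x
assigns while _ ⟦ P ⟧ x = assigns P x
assigns _ _ = false

arr-frame : ∀ {P σ t τ} → ⟨ P , σ ⟩⇓[ t ] τ → ∀ a → stores P a ≡ false → arr τ a ≡ arr σ a
arr-frame ⇓skip a _ = refl
arr-frame ⇓const a _ = refl
arr-frame ⇓copy a _ = refl
arr-frame ⇓inc a _ = refl
arr-frame ⇓dec a _ = refl
arr-frame ⇓load a _ = refl
arr-frame ⇓store a eq rewrite eq = refl
arr-frame (⇓seq {P} p q) a eq = trans (arr-frame q a (∨-conicalʳ (stores P a) _ eq)) (arr-frame p a (∨-conicalˡ _ _ eq))
arr-frame (⇓then _ p) a eq = arr-frame p a (∨-conicalˡ _ _ eq)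
arr-frame (⇓else {P = P} _ p) a eq = arr-frame p a (∨-conicalʳ (stores P a) _ eq)
arr-frame (⇓loop _ p q) a eq = trans (arr-frame q a eq) (arr-frame p a eq)
arr-frame (⇓exit _) a _ = refl

reg-frame : ∀ {P σ t τ} → ⟨ P , σ ⟩⇓[ t ] τ → ∀ x → assigns P x ≡ false → reg τ x ≡ reg σ x
reg-frame ⇓skip x _ = refl
reg-frame ⇓const x eq rewrite eq = refl
reg-frame ⇓copy x eq rewrite eq = refl
reg-frame ⇓inc x eq rewrite eq = refl
reg-frame ⇓dec x eq rewrite eq = refl
reg-frame ⇓load x eq rewrite eq = refl
reg-frame ⇓store x _ = refl
reg-frame (⇓seq {P} p q) x eq = trans (reg-frame q x (∨-conicalʳ (assigns P x) _ eq)) (reg-frame p x (∨-conicalˡ _ _ eq))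
reg-frame (⇓then _ p) x eq = reg-frame p x (∨-conicalˡ _ _ eq)
reg-frame (⇓else {P = P} _ p) x eq = reg-frame p x (∨-conicalʳ (assigns P x) _ eq)
reg-frame (⇓loop _ p q) x eq = trans (reg-frame q x eq) (reg-frame p x eq)
reg-frame (⇓exit _) x _ = refl

record Frame (P : Prog) (σ τ : State) : Set where
  field
    arrs : ∀ a → stores P a ≡ false → arr τ a ≡ arr σ a
    regs : ∀ x → assigns P x ≡ false → reg τ x ≡ reg σ x

open Frame public

consequence : ∀ {P σ T Φ Ψ} → (∀ {τ} → Frame P σ τ → Φ τ → Ψ τ) →
  Terminates P σ T Φ → Terminates P σ T Ψ
consequence Φ⇒Ψ (halts t≤ run post) =
  halts t≤ run (Φ⇒Ψ (record { arrs = arr-frame run ; regs = reg-frame run }) post)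

loosen : ∀ {P σ S T Φ} → S ≤ T → Terminates P σ S Φ → Terminates P σ T Φ
loosen S≤T (halts t≤ run post) = halts (≤-trans t≤ S≤T) run post

infixr 5 _⨟_

-- The continuation also receives the frame of `P`, so postconditions need not carry along data that
-- `P` leaves alone.
_⨟_ : ∀ {P Q σ S T Φ Ψ} → Terminates P σ S Φ →
  (∀ {ρ} → Frame P σ ρ → Φ ρ → Terminates Q ρ T Ψ) → Terminates (P ⨾ Q) σ (S + T) Ψ
halts s≤ run-P post ⨟ rest with rest (record { arrs = arr-frame run-P ; regs = reg-frame run-P }) post
... | halts t≤ run-Q post′ = halts (+-mono-≤ s≤ t≤) (⇓seq run-P run-Q) post′

-- For a loop-free block this evaluates to statements about the updated arrays and registers. Loops
-- have no computable precondition here and are left to `for-each`.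
wp : Prog → (State → Set) → State → Set
wp skip           Φ σ = Φ σ
wp (x ≔ n)        Φ σ = Φ (σ [ x ≔ʳ n ])
wp (x ← y)        Φ σ = Φ (σ [ x ≔ʳ reg σ y ])
wp (inc x)        Φ σ = Φ (σ [ x ≔ʳ suc (reg σ x) ])
wp (dec x)        Φ σ = Φ (σ [ x ≔ʳ pred (reg σ x) ])
wp (x ← a ⟨ y ⟩)  Φ σ = Φ (σ [ x ≔ʳ arr σ a (reg σ y) ])
wp (a ⟨ x ⟩← y)   Φ σ = Φ (σ [ a , reg σ x ≔ᵃ reg σ y ])
wp (P ⨾ Q)        Φ σ = wp P (wp Q Φ) σ
wp if b ⟦ P ∣ Q ⟧ Φ σ = (test b σ ≡ true → wp P Φ σ) × (test b σ ≡ false → wp Q Φ σ)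
wp while _ ⟦ _ ⟧  Φ σ = ⊥

-- Only an upper bound on the time of loop-free code: both branches of a conditional are counted.
instructions : Prog → ℕ
instructions (P ⨾ Q) = instructions P + instructions Q
instructions if _ ⟦ P ∣ Q ⟧ = suc (instructions P + instructions Q)
instructions while _ ⟦ P ⟧ = suc (instructions P)
instructions _ = 1

straight : ∀ P {Φ σ} → wp P Φ σ → Terminates P σ (instructions P) Φ
straight skip φ = halts ≤-refl ⇓skip φ
straight (_ ≔ _) φ = halts ≤-refl ⇓const φ
straight (_ ← _) φ = halts ≤-refl ⇓copy φ
straight (inc _) φ = halts ≤-refl ⇓inc φ
straight (dec _) φ = halts ≤-refl ⇓dec φ
straight (_ ← _ ⟨ _ ⟩) φ = halts ≤-refl ⇓load φ
straight (_ ⟨ _ ⟩← _) φ = halts ≤-refl ⇓store φ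
straight (P ⨾ Q) φ = straight P φ ⨟ λ _ → straight Q
straight if b ⟦ P ∣ Q ⟧ {σ = σ} (φ , ψ) with test b σ in eq
... | true with straight P (φ refl)
...   | halts t≤ run post = halts (s≤s (≤-trans t≤ (m≤m+n _ _))) (⇓then eq run) post
straight if b ⟦ P ∣ Q ⟧ {σ = σ} (φ , ψ) | false with straight Q (ψ refl)
...   | halts t≤ run post = halts (s≤s (≤-trans t≤ (m≤n+m _ (instructions P)))) (⇓else eq run) post

branch : ∀ {b P Q σ T Φ} → (test b σ ≡ true → Terminates P σ T Φ) →
  (test b σ ≡ false → Terminates Q σ T Φ) → Terminates if b ⟦ P ∣ Q ⟧ σ (suc T) Φ
branch {b} {σ = σ} P-halts Q-halts with test b σ in eq
... | true with P-halts refl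
...   | halts t≤ run post = halts (s≤s t≤) (⇓then eq run) post
branch {b} {σ = σ} P-halts Q-halts | false with Q-halts refl
...   | halts t≤ run post = halts (s≤s t≤) (⇓else eq run) post

-- Amortised rule: the iteration at `x` may spend `K * w x`. The strict inequality pays for the
-- successful loop test, and the outer `suc` for the final failing one. The processed elements pile
-- up in reverse, whence `ʳ++`.
for-each : ∀ {A : Set} {b P} (I : List A → List A → State → Set) (K : ℕ) (w : A → ℕ) {T : A → ℕ} →
  (∀ x → T x < K * w x) →
  (∀ {done} σ → I done [] σ → test b σ ≡ false) →
  (∀ {done x todo} σ → I done (x ∷ todo) σ →
    test b σ ≡ true × Terminates P σ (T x) (I (x ∷ done) todo)) →
  ∀ {done} todo {σ} → I done todo σ →
  Terminates while b ⟦ P ⟧ σ (suc (K * sum (map w todo))) (I (todo ʳ++ done) [])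
for-each I K w T< exit step [] inv = halts (s≤s z≤n) (⇓exit (exit _ inv)) inv
for-each I K w {T} T< exit step (x ∷ todo) inv with step _ inv
... | go , halts {s} s≤ run-P inv′ with for-each I K w T< exit step todo inv′
...   | halts {t} t≤ run-loop post = halts (s≤s bound) (⇓loop go run-P run-loop) post
  where
  bound : s + t ≤ K * (w x + sum (map w todo))
  bound = begin
    s + t                            ≤⟨ +-mono-≤ s≤ t≤ ⟩
    T x + suc (K * sum (map w todo)) ≡⟨ +-suc (T x) _ ⟩
    suc (T x) + K * sum (map w todo) ≤⟨ +-monoˡ-≤ _ (T< x) ⟩
    K * w x + K * sum (map w todo)   ≡⟨ *-distribˡ-+ K (w x) _ ⟨
    K * (w x + sum (map w todo))     ∎
    where open ≤-Reasoning

sum-ones : ∀ {A : Set} (xs : List A) → sum (map (λ _ → 1) xs) ≡ length xs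
sum-ones [] = refl
sum-ones (_ ∷ xs) = cong suc (sum-ones xs)

-- Lists stored in arrays

Stream : (ℕ → ℕ) → ℕ → List ℕ → Set
Stream f p xs = ∀ i → f (p + i) ≡ xs ‼ i

stream-head : ∀ f p {x xs} → Stream f p (x ∷ xs) → f p ≡ x
stream-head f p str = trans (cong f (sym (+-identityʳ p))) (str 0)

stream-tail : ∀ f p {x xs} → Stream f p (x ∷ xs) → Stream f (suc p) xs
stream-tail f p str i = trans (cong f (sym (+-suc p i))) (str (suc i))

Holds : (ℕ → ℕ) → List ℕ → Set
Holds f xs = ∀ i → f i ≡ xs ‼ i

private
  ‼-append : ∀ xs x i → (xs ++ x ∷ []) ‼ i ≡ (if i ≡ᵇ length xs then x else (xs ‼ i))
  ‼-append [] x zero = refl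
  ‼-append [] x (suc i) = refl
  ‼-append (_ ∷ xs) x zero = refl
  ‼-append (_ ∷ xs) x (suc i) = ‼-append xs x i

  ‼-replace : ∀ xs x y ys i → (xs ++ y ∷ ys) ‼ i ≡ (if i ≡ᵇ length xs then y else ((xs ++ x ∷ ys) ‼ i))
  ‼-replace [] x y ys zero = refl
  ‼-replace [] x y ys (suc i) = refl
  ‼-replace (_ ∷ xs) x y ys zero = refl
  ‼-replace (_ ∷ xs) x y ys (suc i) = ‼-replace xs x y ys i

  if-cong : ∀ b {x y z : ℕ} → y ≡ z → (if b then x else y) ≡ (if b then x else z)
  if-cong true _ = refl
  if-cong false eq = eq

holds-append : ∀ {f xs k x} → Holds f xs → k ≡ length xs → Holds (update f k x) (xs ++ x ∷ [])
holds-append {xs = xs} {x = x} holds refl i = trans (if-cong (i ≡ᵇ length xs) (holds i)) (sym (‼-append xs x i))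

-- Cells past the end already contain 0, so a cell can be reserved without a store. This is how room
-- is kept for a degree that is known only after its neighbours have been written.
holds-append-0 : ∀ {f xs} → Holds f xs → Holds f (xs ++ 0 ∷ [])
holds-append-0 {f} {xs} holds i = trans (holds i) (sym (trans (‼-append xs 0 i) (beyond xs i)))
  where
  beyond : ∀ xs i → (if i ≡ᵇ length xs then 0 else (xs ‼ i)) ≡ xs ‼ i
  beyond [] zero = refl
  beyond [] (suc i) = refl
  beyond (x ∷ xs) zero = refl
  beyond (x ∷ xs) (suc i) = beyond xs i

holds-replace : ∀ {f} xs {k x y ys} → Holds f (xs ++ x ∷ ys) → k ≡ length xs →
  Holds (update f k y) (xs ++ y ∷ ys)
holds-replace xs {x = x} {y} {ys} holds refl i =
  trans (if-cong (i ≡ᵇ length xs) (holds i)) (sym (‼-replace xs x y ys i))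

holds⇒HasOutput : ∀ {σ} ys → Holds (arr σ 1) ys → HasOutput σ ys
holds⇒HasOutput ys holds =
  trans (map-cong holds (upTo (length ys))) (trans (map-upTo (ys ‼_) (length ys)) (entries ys))
  where
  entries : ∀ ys → applyUpTo (ys ‼_) (length ys) ≡ ys
  entries [] = refl
  entries (y ∷ ys) = cong (y ∷_) (entries ys)

-- The kernelization program

-- #p and #q are positions in the input and in the output, #s is the stamp of the current vertex
-- and #f the next fresh class.  In renumber, #q counts the new vertices.
#0 #n #u #p #deg #w #c #s #t #f #q #d #slot #1 #2 : Reg
#0 = 0
#n = 1
#u = 2
#p = 3
#deg = 4
#w = 5
#c = 6
#s = 7
#t = 8
#f = 9
#q = 10
#d = 11
#slot = 12
#1 = 13
#2 = 14

aIn aOut aClass aStamp aFresh aSeen aDead aCount aLast aId : Arr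
aIn = 0
aOut = 1
aClass = 2
aStamp = 3
aFresh = 4
aSeen = 5
aDead = 6
aCount = 7
aLast = 8
aId = 9

split : Prog
split =
  #c ← aClass ⟨ #w ⟩ ⨾
  #t ← aStamp ⟨ #c ⟩ ⨾
  if #t ≐ #s ⟦ skip ∣ aStamp ⟨ #c ⟩← #s ⨾ aFresh ⟨ #c ⟩← #f ⨾ inc #f ⟧ ⨾
  #t ← aFresh ⟨ #c ⟩ ⨾
  aClass ⟨ #w ⟩← #t

scan-neighbours : Prog
scan-neighbours = while #0 ≺ #deg ⟦ #w ← aIn ⟨ #p ⟩ ⨾ split ⨾ inc #p ⨾ dec #deg ⟧

split-self : Bool → Prog
split-self true  = #w ← #u ⨾ split
split-self false = skip

for-vertices : Prog → Prog
for-vertices P = #u ≔ 0 ⨾ while #u ≺ #n ⟦ P ⨾ inc #u ⟧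

-- Closed neighbourhoods classify vertices by true twins, open ones by false twins. Neither `#s` nor
-- `#f` is reset, so a second call continues the numbering of the first.
refine : Bool → Prog
refine closed = (#0 ≔ 0 ⨾ #p ≔ 1 ⨾ inc #f) ⨾ for-vertices
  (inc #s ⨾ split-self closed ⨾ (#deg ← aIn ⟨ #p ⟩ ⨾ inc #p) ⨾ scan-neighbours)

-- Partition refinement

-- The list consists of the vertices numbered from `k` up to the last one. It ties the remaining
-- list of `for-each` to the value of the loop counter.
Counting : ∀ {n} → ℕ → List (Fin n) → Set
Counting {n} k []       = k ≡ n
Counting     k (v ∷ vs) = toℕ v ≡ k × Counting (suc k) vs

counting-tabulate : ∀ {n} m {k} (f : Fin m → Fin n) → (∀ i → toℕ (f i) ≡ k + toℕ i) → k + m ≡ n →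
  Counting k (tabulate f)
counting-tabulate zero {k} f f≡ k+m≡n = trans (sym (+-identityʳ k)) k+m≡n
counting-tabulate (suc m) {k} f f≡ k+m≡n =
    trans (f≡ Fin.zero) (+-identityʳ k)
  , counting-tabulate m (f ∘ Fin.suc) (λ i → trans (f≡ (Fin.suc i)) (+-suc k (toℕ i)))
      (trans (sym (+-suc k m)) k+m≡n)

counting-allFin : ∀ n → Counting 0 (allFin n)
counting-allFin n = counting-tabulate n id (λ _ → refl) refl

module _ {n : ℕ} (K : ℕ) (weight : Fin n → ℕ) where

  -- The body must establish `J` for every value of `#u`, so that `J` survives the increment of the
  -- counter. The two steps of slack in the bound on `T` pay for that increment and the loop test.
  each-vertex : ∀ {P} (J : ℕ → List (Fin n) → State → Set) {T : Fin n → ℕ} →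
    (∀ v → suc (T v) < K * weight v) →
    assigns P #u ≡ false → assigns P #n ≡ false →
    (∀ v todo {σ} → reg σ #u ≡ toℕ v → J (toℕ v) (v ∷ todo) σ →
      Terminates P σ (T v) (λ τ → ∀ m → J (suc (toℕ v)) todo (τ [ #u ≔ʳ m ]))) →
    ∀ {σ} → reg σ #n ≡ n → J 0 (allFin n) (σ [ #u ≔ʳ 0 ]) →
    Terminates (for-vertices P) σ (2 + K * sum (map weight (allFin n))) (J n [])
  each-vertex {P} J {T} T< u-kept n-kept step {σ} σn j =
    -- With the final state itself as postcondition, matching on `refl` makes the state after the
    -- block definitionally known.
    straight (#u ≔ 0) {Φ = _≡ σ [ #u ≔ʳ 0 ]} refl ⨟ λ { _ refl →
      consequence (λ _ (count , _ , j) → subst (λ k → J k [] _) count j)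
        (for-each I K weight {T = λ v → T v + 1}
          (λ v → ≤-trans (≤-reflexive (cong suc (+-comm (T v) 1))) (T< v))
          (λ {d} → exit {d}) (λ {d} → body {d}) {done = []} (allFin n) (counting-allFin n , σn , j)) }
    where
    I : List (Fin n) → List (Fin n) → State → Set
    I _ todo σ = Counting (reg σ #u) todo × reg σ #n ≡ n × J (reg σ #u) todo σ

    exit : ∀ {done} σ → I done [] σ → test (#u ≺ #n) σ ≡ false
    exit σ (count , σn , _) rewrite count | σn = <ᵇ-false n

    body : ∀ {done v todo} σ → I done (v ∷ todo) σ →
      test (#u ≺ #n) σ ≡ true × Terminates (P ⨾ inc #u) σ (T v + 1) (I (v ∷ done) todo)
    body {v = v} {todo} σ ((u≡ , count) , σn , j) =
        <ᵇ-true (subst (reg σ #u <_) (sym σn) (subst (_< n) u≡ (Fin.toℕ<n v)))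
      , (step v todo (sym u≡) (subst (λ k → J k (v ∷ todo) σ) (sym u≡) j) ⨟ λ {ρ} frame j′ →
          let ρu = trans (regs frame #u u-kept) (sym u≡)
              ρu′ = cong suc (trans (regs frame #u u-kept) refl) in
          straight (inc #u)
            ( subst (λ k → Counting k todo) (sym ρu′) count
            , trans (regs frame #n n-kept) σn
            , subst (λ k → J k todo (ρ [ #u ≔ʳ suc (reg ρ #u) ])) (cong suc (sym ρu)) (j′ (suc (reg ρ #u)))))

module _ {n : ℕ} where

  private
    V : Set
    V = Fin n

  -- The neighbourhood of one vertex refines the classes C₀: a class met for
  -- the first time is stamped s, and its members move to a fresh class.
  record Splitting (C₀ : V → ℕ) (f₀ : ℕ) (done : List V) (C St Fr : ℕ → ℕ) (s f : ℕ) : Set where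
    field
      untouched : ∀ {v} → v List.∉ done → C (toℕ v) ≡ C₀ v
      touched   : ∀ {v} → v List.∈ done → St (C₀ v) ≡ s × C (toℕ v) ≡ Fr (C₀ v)
      stamp≤    : ∀ c → St c ≤ s
      fresh     : ∀ {c} → St c ≡ s → f₀ ≤ Fr c × Fr c < f
      injective : ∀ {c c′} → St c ≡ s → St c′ ≡ s → Fr c ≡ Fr c′ → c ≡ c′
      f₀≤f      : f₀ ≤ f

  module _ {C₀ : V → ℕ} {f₀ : ℕ} {done : List V} {C St Fr : ℕ → ℕ} {s f : ℕ}
           (inv : Splitting C₀ f₀ done C St Fr s f) where
    open Splitting inv

    -- An unstamped class contains no moved vertex, so redirecting it disturbs nothing; `f` exceeds
    -- every target in use, which keeps targets distinct.
    stamp : ∀ {c} → St c ≢ s → Splitting C₀ f₀ done C (update St c s) (update Fr c f) s (suc f)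
    stamp {c} unstamped = record
      { untouched = untouched
      ; touched = λ v∈ → let (stamped , moved) = touched v∈
                             C₀v≢c = λ eq → unstamped (subst (λ c → St c ≡ s) eq stamped) in
          trans (update-≢ St C₀v≢c) stamped , trans moved (sym (update-≢ Fr C₀v≢c))
      ; stamp≤ = stamp≤′
      ; fresh = fresh′
      ; injective = injective′
      ; f₀≤f = m≤n⇒m≤1+n f₀≤f
      }
      where
      stamp≤′ : ∀ c′ → update St c s c′ ≤ s
      stamp≤′ c′ with c′ ≟ c
      ... | yes refl = ≤-reflexive (update-≡ St c)
      ... | no c′≢c = subst (_≤ s) (sym (update-≢ St c′≢c)) (stamp≤ c′)

      old : ∀ {c′} → c′ ≢ c → update St c s c′ ≡ s → St c′ ≡ s
      old c′≢c = trans (sym (update-≢ St c′≢c))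

      fresh′ : ∀ {c′} → update St c s c′ ≡ s → f₀ ≤ update Fr c f c′ × update Fr c f c′ < suc f
      fresh′ {c′} stamped with c′ ≟ c
      ... | yes refl rewrite update-≡ Fr c {f} = f₀≤f , ≤-refl
      ... | no c′≢c rewrite update-≢ Fr {a = f} c′≢c =
        let (lo , hi) = fresh (old c′≢c stamped) in lo , m<n⇒m<1+n hi

      injective′ : ∀ {c₁ c₂} → update St c s c₁ ≡ s → update St c s c₂ ≡ s →
        update Fr c f c₁ ≡ update Fr c f c₂ → c₁ ≡ c₂
      injective′ {c₁} {c₂} st₁ st₂ eq with c₁ ≟ c | c₂ ≟ c
      ... | yes refl | yes refl = refl
      ... | yes refl | no c₂≢c rewrite update-≡ Fr c {f} | update-≢ Fr {a = f} c₂≢c =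
        contradiction (sym eq) (<⇒≢ (proj₂ (fresh (old c₂≢c st₂))))
      ... | no c₁≢c | yes refl rewrite update-≡ Fr c {f} | update-≢ Fr {a = f} c₁≢c =
        contradiction eq (<⇒≢ (proj₂ (fresh (old c₁≢c st₁))))
      ... | no c₁≢c | no c₂≢c =
        injective (old c₁≢c st₁) (old c₂≢c st₂)
          (trans (sym (update-≢ Fr c₁≢c)) (trans eq (update-≢ Fr c₂≢c)))

    -- A vertex not yet moved still carries its old class, so the class read from the array is
    -- `C₀ w`. A vertex met twice would be moved out of a fresh class; uniqueness of the neighbour
    -- lists excludes this.
    move : ∀ {w i} → i ≡ toℕ w → w List.∉ done → St (C i) ≡ s →
      Splitting C₀ f₀ (w ∷ done) (update C i (Fr (C i))) St Fr s f
    move {w} refl w∉ stamped = record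
      { untouched = λ v∉ → trans (update-≢ C (v∉ ∘ here ∘ Fin.toℕ-injective)) (untouched (v∉ ∘ there))
      ; touched = touched′
      ; stamp≤ = stamp≤
      ; fresh = fresh
      ; injective = injective
      ; f₀≤f = f₀≤f
      }
      where
      touched′ : ∀ {v} → v List.∈ w ∷ done →
        St (C₀ v) ≡ s × update C (toℕ w) (Fr (C (toℕ w))) (toℕ v) ≡ Fr (C₀ v)
      touched′ (here refl) =
          subst (λ c → St c ≡ s) (untouched w∉) stamped
        , trans (update-≡ C (toℕ w)) (cong Fr (untouched w∉))
      touched′ {v} (there v∈) = let (st , moved) = touched v∈ in
          st , trans (update-≢ C λ eq → w∉ (subst (List._∈ done) (Fin.toℕ-injective eq) v∈)) moved

  record Partition (R : V → V → Set) (C St : ℕ → ℕ) (s f : ℕ) : Set where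
    field
      class<   : ∀ (v : V) → C (toℕ v) < f
      stamp≤   : ∀ c → St c ≤ s
      class⇔   : ∀ (v v′ : V) → C (toℕ v) ≡ C (toℕ v′) ⇔ R v v′

  -- Raising the stamp unstamps all classes at once, which makes `fresh` and `injective` vacuous
  -- whatever `Fr` contains.
  start-splitting : ∀ {R C St Fr s f} → Partition R C St s f →
    Splitting (C ∘ toℕ) f [] C St Fr (suc s) f
  start-splitting part = record
    { untouched = λ _ → refl
    ; touched = λ ()
    ; stamp≤ = λ c → m≤n⇒m≤1+n (stamp≤ c)
    ; fresh = λ {c} eq → contradiction eq (<⇒≢ (s≤s (stamp≤ c)))
    ; injective = λ {c} eq → contradiction eq (<⇒≢ (s≤s (stamp≤ c)))
    ; f₀≤f = ≤-refl
    }
    where open Partition part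

  Agree : (V → List V) → ℕ → V → V → Set
  Agree B k v v′ = ∀ u → toℕ u < k → v List.∈ B u ⇔ v′ List.∈ B u

  -- Moved vertices have classes at least `f₀` and unmoved ones below `f₀`, so membership in `B u`
  -- separates them. Within either kind the old classes decide, because `Fr` is injective on stamped
  -- classes.
  finish-splitting : ∀ {B C₀ St₀ s₀ f₀ C St Fr s f u done} →
    Partition (Agree B (toℕ u)) C₀ St₀ s₀ f₀ → Splitting (C₀ ∘ toℕ) f₀ done C St Fr s f →
    (∀ v → v List.∈ done ⇔ v List.∈ B u) →
    Partition (Agree B (suc (toℕ u))) C St s f
  finish-splitting {B} {C₀} {f₀ = f₀} {C = C} {Fr = Fr} {f = f} {u} {done} part inv done⇔ = record
    { class< = class<′
    ; stamp≤ = Splitting.stamp≤ inv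
    ; class⇔ = λ v v′ → mk⇔ (separated v v′) (together v v′)
    }
    where
    open Partition part
    open Splitting inv hiding (stamp≤)

    done? : ∀ v → Dec (v List.∈ done)
    done? v = member? Fin._≟_ v done

    class<′ : ∀ v → C (toℕ v) < f
    class<′ v with done? v
    ... | yes v∈ = let (st , moved) = touched v∈ in subst (_< f) (sym moved) (proj₂ (fresh st))
    ... | no v∉ = subst (_< f) (sym (untouched v∉)) (<-≤-trans (class< v) f₀≤f)

    apart : ∀ {v v′} → v List.∈ done → v′ List.∉ done → C (toℕ v) ≢ C (toℕ v′)
    apart {v} {v′} v∈ v′∉ eq = let (st , moved) = touched v∈ in
      <⇒≱ (class< v′) (subst (f₀ ≤_) (trans (sym moved) (trans eq (untouched v′∉))) (proj₁ (fresh st)))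

    extend : ∀ {v v′} → C₀ (toℕ v) ≡ C₀ (toℕ v′) → v List.∈ B u ⇔ v′ List.∈ B u → Agree B (suc (toℕ u)) v v′
    extend {v} {v′} eq u⇔ x x≤u with m<1+n⇒m<n∨m≡n x≤u
    ... | inj₁ x<u = to (class⇔ v v′) eq x x<u
    ... | inj₂ x≡u with Fin.toℕ-injective x≡u
    ...   | refl = u⇔

    separated : ∀ v v′ → C (toℕ v) ≡ C (toℕ v′) → Agree B (suc (toℕ u)) v v′
    separated v v′ eq with done? v | done? v′
    ... | yes v∈ | no v′∉ = contradiction eq (apart v∈ v′∉)
    ... | no v∉ | yes v′∈ = contradiction (sym eq) (apart v′∈ v∉)
    ... | yes v∈ | yes v′∈ =
      let (st , moved) = touched v∈ ; (st′ , moved′) = touched v′∈ in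
      extend (injective st st′ (trans (sym moved) (trans eq moved′)))
        (mk⇔ (λ _ → to (done⇔ v′) v′∈) (λ _ → to (done⇔ v) v∈))
    ... | no v∉ | no v′∉ =
      extend (trans (sym (untouched v∉)) (trans eq (untouched v′∉)))
        (mk⇔ (λ v∈B → contradiction (from (done⇔ v) v∈B) v∉)
             (λ v′∈B → contradiction (from (done⇔ v′) v′∈B) v′∉))

    together : ∀ v v′ → Agree B (suc (toℕ u)) v v′ → C (toℕ v) ≡ C (toℕ v′)
    together v v′ agree with done? v | done? v′
      | from (class⇔ v v′) (λ x x<u → agree x (m<n⇒m<1+n x<u))
    ... | yes v∈ | no v′∉ | _ = contradiction (from (done⇔ v′) (to (agree u ≤-refl) (to (done⇔ v) v∈))) v′∉
    ... | no v∉ | yes v′∈ | _ = contradiction (from (done⇔ v) (from (agree u ≤-refl) (to (done⇔ v′) v′∈))) v∉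
    ... | yes v∈ | yes v′∈ | eq = trans (proj₂ (touched v∈)) (trans (cong Fr eq) (sym (proj₂ (touched v′∈))))
    ... | no v∉ | no v′∉ | eq = trans (untouched v∉) (trans eq (sym (untouched v′∉)))

  SplitState : (V → ℕ) → ℕ → List V → State → Set
  SplitState C₀ f₀ done σ =
    Splitting C₀ f₀ done (arr σ aClass) (arr σ aStamp) (arr σ aFresh) (reg σ #s) (reg σ #f)

  split-correct : ∀ {C₀ f₀ done w σ} → SplitState C₀ f₀ done σ → reg σ #w ≡ toℕ w → w List.∉ done →
    Terminates split σ (instructions split) (SplitState C₀ f₀ (w ∷ done))
  split-correct {σ = σ} inv w≡ w∉ = straight split
    ( (λ stamped → move inv w≡ w∉ (≡ᵇ-true stamped))
    , (λ unstamped → move (stamp inv (≡ᵇ-false unstamped)) w≡ w∉ (update-≡ (arr σ aStamp) (arr σ aClass (reg σ #w)))))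

  ∈-ʳ++ : ∀ {v : V} xs {ys} → v List.∈ xs ʳ++ ys ⇔ (v List.∈ xs ⊎ v List.∈ ys)
  ∈-ʳ++ [] = mk⇔ inj₂ λ { (inj₁ ()) ; (inj₂ v∈) → v∈ }
  ∈-ʳ++ (x ∷ xs) = ⇔-trans (∈-ʳ++ xs) (mk⇔
    (λ { (inj₁ v∈) → inj₁ (there v∈) ; (inj₂ (here eq)) → inj₁ (here eq) ; (inj₂ (there v∈)) → inj₂ v∈ })
    (λ { (inj₁ (here eq)) → inj₂ (here eq) ; (inj₁ (there v∈)) → inj₁ v∈ ; (inj₂ v∈) → inj₂ (there v∈) }))

  scan-correct : ∀ {C₀ f₀ done rest σ} ws → Unique ws → All (List._∉ done) ws →
    reg σ #0 ≡ 0 → reg σ #deg ≡ length ws →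
    Stream (arr σ aIn) (reg σ #p) (map toℕ ws ++ rest) → SplitState C₀ f₀ done σ →
    Terminates scan-neighbours σ (suc (20 * length ws))
      (λ τ → SplitState C₀ f₀ (ws ʳ++ done) τ × Stream (arr τ aIn) (reg τ #p) rest)
  scan-correct {C₀} {f₀} {rest = rest} ws ws! ws∉ zero≡ deg≡ str inv =
    loosen (≤-reflexive (cong (λ m → suc (20 * m)) (sum-ones ws)))
      (consequence (λ _ inv → proj₁ inv , proj₁ (proj₂ inv))
        -- One load, the nine steps of `split` and two counter updates make 12. The rates 20 for
        -- inner loops and 40 for loops over vertices are generous common values.
        (for-each I 20 (λ _ → 1) {T = λ _ → 12} (λ _ → m≤m+n 13 7) exit body ws
          (inv , str , zero≡ , deg≡ , ws! , ws∉)))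
    where
    I : List V → List V → State → Set
    I done todo σ = SplitState C₀ f₀ done σ × Stream (arr σ aIn) (reg σ #p) (map toℕ todo ++ rest)
      × reg σ #0 ≡ 0 × reg σ #deg ≡ length todo × Unique todo × All (List._∉ done) todo

    exit : ∀ {done} σ → I done [] σ → test (#0 ≺ #deg) σ ≡ false
    exit σ (_ , _ , zero≡ , deg≡ , _) rewrite zero≡ | deg≡ = refl

    body : ∀ {done w todo} σ → I done (w ∷ todo) σ → test (#0 ≺ #deg) σ ≡ true ×
      Terminates (#w ← aIn ⟨ #p ⟩ ⨾ split ⨾ inc #p ⨾ dec #deg) σ 12 (I (w ∷ done) todo)
    body {done} {w} {todo} σ (inv , str , zero≡ , deg≡ , w≢ ∷ todo! , w∉ ∷ todo∉) =
        <ᵇ-true (subst (_< reg σ #deg) (sym zero≡) (subst (0 <_) (sym deg≡) (s≤s z≤n)))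
      , (straight (#w ← aIn ⟨ #p ⟩) {Φ = _≡ σ [ #w ≔ʳ arr σ aIn (reg σ #p) ]} refl ⨟ λ { _ refl →
         split-correct inv (stream-head (arr σ aIn) (reg σ #p) str) w∉ ⨟ λ {ρ} frame inv′ →
         straight (inc #p ⨾ dec #deg)
           ( inv′
           , subst (λ a → Stream a (suc (reg ρ #p)) (map toℕ todo ++ rest)) (sym (arrs frame aIn refl))
               (subst (λ p → Stream (arr σ aIn) (suc p) (map toℕ todo ++ rest)) (sym (regs frame #p refl))
                 (stream-tail (arr σ aIn) (reg σ #p) str))
           , trans (regs frame #0 refl) zero≡
           , cong pred (trans (regs frame #deg refl) deg≡)
           , todo!
           , All.zipWith (λ (w≢v , v∉) → λ { (here eq) → w≢v (sym eq) ; (there v∈) → v∉ v∈ }) (w≢ , todo∉)) })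

-- Deleting twins and writing the kernel

drop-trueTwins drop-falseTwins renumber scan-output skip-block output kernelize : Prog

drop-trueTwins = for-vertices
  (#0 ≔ 0 ⨾ #1 ≔ 1 ⨾
   #c ← aClass ⟨ #u ⟩ ⨾ aClass ⟨ #u ⟩← #0 ⨾
   #t ← aSeen ⟨ #c ⟩ ⨾
   if #t ≐ #1 ⟦ aDead ⟨ #u ⟩← #1 ∣ aSeen ⟨ #c ⟩← #1 ⟧)

-- A third survivor of a class dies together with the second, which brings the count back to 1. The
-- first one always stays, so only the second is remembered in `aLast`.
drop-falseTwins = for-vertices
  (#0 ≔ 0 ⨾ #1 ≔ 1 ⨾ #2 ≔ 2 ⨾
   #t ← aDead ⟨ #u ⟩ ⨾
   if #t ≐ #0
     ⟦ #c ← aClass ⟨ #u ⟩ ⨾ #t ← aCount ⟨ #c ⟩ ⨾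
       if #t ≐ #0 ⟦ aCount ⟨ #c ⟩← #1
       ∣ if #t ≐ #1 ⟦ aCount ⟨ #c ⟩← #2 ⨾ aLast ⟨ #c ⟩← #u
       ∣ aDead ⟨ #u ⟩← #1 ⨾ #t ← aLast ⟨ #c ⟩ ⨾ aDead ⟨ #t ⟩← #1 ⨾ aCount ⟨ #c ⟩← #1 ⟧ ⟧
     ∣ skip ⟧)

renumber = #q ≔ 0 ⨾ for-vertices
  (#0 ≔ 0 ⨾ aId ⟨ #u ⟩← #q ⨾ #t ← aDead ⟨ #u ⟩ ⨾ if #t ≐ #0 ⟦ inc #q ∣ skip ⟧)

scan-output = while #0 ≺ #deg
  ⟦ #w ← aIn ⟨ #p ⟩ ⨾ #t ← aDead ⟨ #w ⟩ ⨾
    if #t ≐ #0 ⟦ #t ← aId ⟨ #w ⟩ ⨾ aOut ⟨ #q ⟩← #t ⨾ inc #q ⨾ inc #d ∣ skip ⟧ ⨾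
    inc #p ⨾ dec #deg ⟧

-- Since the machine can only increment, passing over the block of a dead vertex costs its degree.
skip-block = while #0 ≺ #deg ⟦ inc #p ⨾ dec #deg ⟧

output =
  (#0 ≔ 0 ⨾ aOut ⟨ #0 ⟩← #q ⨾ #q ≔ 1 ⨾ #p ≔ 1) ⨾ for-vertices
  ((#0 ≔ 0 ⨾ #deg ← aIn ⟨ #p ⟩ ⨾ inc #p ⨾ #t ← aDead ⟨ #u ⟩) ⨾
   if #t ≐ #0
     ⟦ (#slot ← #q ⨾ inc #q ⨾ #d ≔ 0) ⨾ scan-output ⨾ aOut ⟨ #slot ⟩← #d
     ∣ skip-block ⟧)

kernelize = (#0 ≔ 0 ⨾ #n ← aIn ⟨ #0 ⟩) ⨾
  refine true ⨾ drop-trueTwins ⨾ refine false ⨾ drop-falseTwins ⨾ renumber ⨾ output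

-- Correctness of the refinement passes

linear< : ∀ a b K d → a < K → b ≤ K → a + b * d < K * suc d
linear< a b K d a<K b≤K = <-≤-trans (+-mono-<-≤ a<K (*-monoˡ-≤ d b≤K)) (≤-reflexive (sym (*-suc K d)))

module Kernelization (G : Graph)
  (nbrs : Fin (Graph.order G) → List (Fin (Graph.order G)))
  (nbrs! : ∀ v → Unique (nbrs v))
  (nbrs⇔ : ∀ v w → w List.∈ nbrs v ⇔ Graph.Adj G v w) where

  open Graph G renaming (order to n)

  V : Set
  V = Fin n

  code : V → List ℕ
  code v = length (nbrs v) ∷ map toℕ (nbrs v)

  weight : V → ℕ
  weight v = suc (length (nbrs v))

  total : ℕ
  total = sum (map weight (allFin n))

  Input : State → Set
  Input σ = Stream (arr σ aIn) 1 (concatMap code (allFin n)) × reg σ #n ≡ n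

  self : Bool → V → List V
  self true  u = [ u ]
  self false u = []

  B : Bool → V → List V
  B closed u = self closed u ++ nbrs u

  self-fresh : ∀ closed u → All (List._∉ self closed u) (nbrs u)
  self-fresh true u = All.tabulate λ { u∈ (here refl) → irrefl refl (to (nbrs⇔ u u) u∈) }
  self-fresh false u = All.tabulate λ { _ () }

  ∈-done : ∀ closed u v → v List.∈ nbrs u ʳ++ self closed u ⇔ v List.∈ B closed u
  ∈-done true u v = ⇔-trans (∈-ʳ++ (nbrs u)) (mk⇔
    (λ { (inj₁ v∈) → there v∈ ; (inj₂ (here eq)) → here eq ; (inj₂ (there ())) })
    (λ { (here eq) → inj₂ (here eq) ; (there v∈) → inj₁ v∈ }))
  ∈-done false u v = ⇔-trans (∈-ʳ++ (nbrs u)) (mk⇔ (λ { (inj₁ v∈) → v∈ ; (inj₂ ()) }) inj₁)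

  -- The frame facts are part of the postcondition because the footprint of `split-self closed` does
  -- not evaluate while `closed` is a variable.
  split-self-correct : ∀ closed {C₀ f₀ u σ} → SplitState C₀ f₀ [] σ → reg σ #u ≡ toℕ u →
    Terminates (split-self closed) σ 10
      (λ τ → SplitState C₀ f₀ (self closed u) τ ×
             arr τ aIn ≡ arr σ aIn × reg τ #p ≡ reg σ #p × reg τ #0 ≡ reg σ #0)
  split-self-correct true {σ = σ} inv σu =
    consequence (λ frame inv → inv , arrs frame aIn refl , regs frame #p refl , regs frame #0 refl)
      (straight (#w ← #u) {Φ = _≡ σ [ #w ≔ʳ reg σ #u ]} refl ⨟ λ { _ refl → split-correct inv σu (λ ()) })
  split-self-correct false inv σu = loosen (s≤s z≤n) (straight skip (inv , refl , refl , refl))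

  -- The hypotheses on memory are those that both calls can meet: stamps are merely bounded by `#s`,
  -- and `aFresh` may hold anything.
  refine-correct : ∀ closed {σ} → Input σ →
    (∀ (v : V) → arr σ aClass (toℕ v) ≡ 0) → (∀ c → arr σ aStamp c ≤ reg σ #s) →
    Terminates (refine closed) σ (5 + 40 * total)
      (λ τ → Partition (Agree (B closed) n) (arr τ aClass) (arr τ aStamp) (reg τ #s) (reg τ #f))
  refine-correct closed {σ} (str , σn) class≡0 stamp≤ =
    straight (#0 ≔ 0 ⨾ #p ≔ 1 ⨾ inc #f) {Φ = _≡ ((σ [ #0 ≔ʳ 0 ]) [ #p ≔ʳ 1 ]) [ #f ≔ʳ suc (reg σ #f) ]} refl
    ⨟ λ { _ refl → consequence (λ _ → proj₁)
      (each-vertex 40 weight J {T = T} T< (u-kept closed) (n-kept closed) step σn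
        -- Before any vertex is processed `Agree` is vacuous, matching the single class 0; the
        -- preliminary `inc #f` puts 0 strictly below the first fresh class.
        (record { class< = λ v → subst (_< suc (reg σ #f)) (sym (class≡0 v)) (s≤s z≤n)
                ; stamp≤ = stamp≤
                ; class⇔ = λ v v′ → mk⇔ (λ _ _ ()) (λ _ → trans (class≡0 v) (sym (class≡0 v′))) }
        , str , refl)) }
    where
    J : ℕ → List V → State → Set
    J k todo σ =
      Partition (Agree (B closed) k) (arr σ aClass) (arr σ aStamp) (reg σ #s) (reg σ #f) ×
      Stream (arr σ aIn) (reg σ #p) (concatMap code todo) × reg σ #0 ≡ 0

    body : Prog
    body = inc #s ⨾ split-self closed ⨾ (#deg ← aIn ⟨ #p ⟩ ⨾ inc #p) ⨾ scan-neighbours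

    u-kept : ∀ closed →
      assigns (inc #s ⨾ split-self closed ⨾ (#deg ← aIn ⟨ #p ⟩ ⨾ inc #p) ⨾ scan-neighbours) #u ≡ false
    u-kept true = refl
    u-kept false = refl

    n-kept : ∀ closed →
      assigns (inc #s ⨾ split-self closed ⨾ (#deg ← aIn ⟨ #p ⟩ ⨾ inc #p) ⨾ scan-neighbours) #n ≡ false
    n-kept true = refl
    n-kept false = refl

    T : V → ℕ
    T v = 1 + (10 + (2 + suc (20 * length (nbrs v))))

    T< : ∀ v → suc (T v) < 40 * weight v
    T< v = linear< 15 20 40 (length (nbrs v)) (m≤m+n 16 24) (m≤m+n 20 20)

    step : ∀ v todo {σ} → reg σ #u ≡ toℕ v → J (toℕ v) (v ∷ todo) σ →
      Terminates body σ (T v) (λ τ → ∀ m → J (suc (toℕ v)) todo (τ [ #u ≔ʳ m ]))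
    step v todo {σ} σu (part , str , zero≡) =
      straight (inc #s) {Φ = _≡ σ [ #s ≔ʳ suc (reg σ #s) ]} refl ⨟ λ { _ refl →
      split-self-correct closed {u = v} (start-splitting part) σu ⨟ λ { {ρ} _ (inv , aIn≡ , p≡ , 0≡) →
      let str′ : Stream (arr ρ aIn) (reg ρ #p) (concatMap code (v ∷ todo))
          str′ = subst (λ a → Stream a (reg ρ #p) (concatMap code (v ∷ todo))) (sym aIn≡)
                   (subst (λ p → Stream (arr σ aIn) p (concatMap code (v ∷ todo))) (sym p≡) str) in
      straight (#deg ← aIn ⟨ #p ⟩ ⨾ inc #p)
        {Φ = _≡ (ρ [ #deg ≔ʳ arr ρ aIn (reg ρ #p) ]) [ #p ≔ʳ suc (reg ρ #p) ]} refl ⨟ λ { _ refl →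
      consequence
        (λ frame (inv , str) m →
            finish-splitting part inv (∈-done closed v)
          , str , trans (regs frame #0 refl) (trans 0≡ zero≡))
        (scan-correct (nbrs v) (nbrs! v) (self-fresh closed v) (trans 0≡ zero≡)
          (stream-head (arr ρ aIn) (reg ρ #p) str′)
          (stream-tail (arr ρ aIn) (reg ρ #p) str′) inv) } } }

  trueTwins⇔Agree : ∀ v v′ → TrueTwins G v v′ ⇔ Agree (B true) n v v′
  trueTwins⇔Agree v v′ = mk⇔
    (λ twins u _ → ⇔-trans (closed⇔ v u) (⇔-trans (twins u) (⇔-sym (closed⇔ v′ u))))
    (λ agree u → ⇔-trans (⇔-sym (closed⇔ v u)) (⇔-trans (agree u (Fin.toℕ<n u)) (closed⇔ v′ u)))
    where
    closed⇔ : ∀ v u → v List.∈ u ∷ nbrs u ⇔ (v ≡ u ⊎ Adj u v)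
    closed⇔ v u = mk⇔
      (λ { (here eq) → inj₁ eq ; (there v∈) → inj₂ (to (nbrs⇔ u v) v∈) })
      (λ { (inj₁ eq) → here eq ; (inj₂ uv) → there (from (nbrs⇔ u v) uv) })

  falseTwins⇔Agree : ∀ v v′ → FalseTwins G v v′ ⇔ Agree (B false) n v v′
  falseTwins⇔Agree v v′ = mk⇔
    (λ twins u _ → ⇔-trans (nbrs⇔ u v) (⇔-trans (twins u) (⇔-sym (nbrs⇔ u v′))))
    (λ agree u → ⇔-trans (⇔-sym (nbrs⇔ u v)) (⇔-trans (agree u (Fin.toℕ<n u)) (nbrs⇔ u v′)))

  -- Survivors of the deletion passes

  alive? : (D : ℕ → ℕ) → U.Decidable (λ (v : V) → D (toℕ v) ≡ 0)
  alive? D v = D (toℕ v) ≟ 0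

  nimAlive : (ℕ → ℕ) → ℕ
  nimAlive D = nimOn G ⟦ alive? D ⟧

  kill : ∀ D (v : V) {i} → i ≡ toℕ v → ∀ x → update D i 1 (toℕ x) ≡ 0 ⇔ (D (toℕ x) ≡ 0 × x ≢ v)
  kill D v refl x with toℕ x ≟ toℕ v
  ... | yes eq = mk⇔
    (λ dead → contradiction (trans (sym (update-≡ D (toℕ v))) (subst (λ i → update D (toℕ v) 1 i ≡ 0) eq dead)) λ ())
    (λ (_ , x≢v) → contradiction (Fin.toℕ-injective eq) x≢v)
  ... | no x≢v = mk⇔
    (λ eq → trans (sym (update-≢ D x≢v)) eq , λ { refl → x≢v refl })
    (λ (eq , _) → trans (update-≢ D x≢v) eq)

  ∈-alive : ∀ D {x : V} → x ∈ ⟦ alive? D ⟧ ⇔ D (toℕ x) ≡ 0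
  ∈-alive D = mk⇔ (∈-⟦⟧⁻ (alive? D)) (∈-⟦⟧⁺ (alive? D))

  nimAlive-all : ∀ D → (∀ (v : V) → D (toℕ v) ≡ 0) → nimAlive D ≡ nim G
  nimAlive-all D D≡0 = cong (nimOn G) (ext λ x → mk⇔ (λ _ → ∈⊤) (λ _ → from (∈-alive D) (D≡0 x)))

  -- C₀ are the classes at the start of the pass, which also resets them for the next refinement.
  -- Of the first k vertices, exactly one of each class stays alive.
  record TrueTwinScan (C₀ : ℕ → ℕ) (k : ℕ) (C D Seen : ℕ → ℕ) : Set where
    field
      class-reset : ∀ {v : V} → toℕ v < k → C (toℕ v) ≡ 0
      class-todo  : ∀ {v : V} → k ≤ toℕ v → C (toℕ v) ≡ C₀ (toℕ v)
      alive-todo  : ∀ {v : V} → k ≤ toℕ v → D (toℕ v) ≡ 0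
      witness     : ∀ {c} → Seen c ≡ 1 → ∃[ a ] (toℕ {n} a < k × D (toℕ a) ≡ 0 × C₀ (toℕ a) ≡ c)
      seen        : ∀ {v : V} → toℕ v < k → D (toℕ v) ≡ 0 → Seen (C₀ (toℕ v)) ≡ 1
      distinct    : ∀ {v w : V} → toℕ v < k → toℕ w < k → D (toℕ v) ≡ 0 → D (toℕ w) ≡ 0 →
                    C₀ (toℕ v) ≡ C₀ (toℕ w) → v ≡ w
      nim≡        : nimAlive D ≡ nim G

  ≤-cases : ∀ {v w : V} → toℕ v < suc (toℕ w) → toℕ v < toℕ w ⊎ v ≡ w
  ≤-cases v≤w with m<1+n⇒m<n∨m≡n v≤w
  ... | inj₁ v<w = inj₁ v<w
  ... | inj₂ v≡w = inj₂ (Fin.toℕ-injective v≡w)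

  earlier : ∀ {v w : V} → toℕ v < toℕ w → v ≢ w
  earlier v<w = <⇒≢ v<w ∘ cong toℕ

  module _ {C₀ C D Seen : ℕ → ℕ} {u : V} {i : ℕ} (i≡ : i ≡ toℕ u)
           (inv : TrueTwinScan C₀ (toℕ u) C D Seen) where
    open TrueTwinScan inv

    private
      reset : ∀ {v : V} → toℕ v < suc (toℕ u) → update C i 0 (toℕ v) ≡ 0
      reset v≤u with ≤-cases v≤u
      ... | inj₁ v<u = trans (update-≢ C λ eq → <⇒≢ v<u (trans eq i≡)) (class-reset v<u)
      ... | inj₂ refl rewrite i≡ = update-≡ C (toℕ u)

      todo : ∀ {v : V} → suc (toℕ u) ≤ toℕ v → update C i 0 (toℕ v) ≡ C₀ (toℕ v)
      todo u<v = trans (update-≢ C λ eq → <⇒≢ u<v (sym (trans eq i≡))) (class-todo (<⇒≤ u<v))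

      Ci≡ : C i ≡ C₀ (toℕ u)
      Ci≡ = trans (cong C i≡) (class-todo ≤-refl)

    drop-twin : (∀ v w → C₀ (toℕ v) ≡ C₀ (toℕ w) → TrueTwins G v w) →
      Seen (C i) ≡ 1 → TrueTwinScan C₀ (suc (toℕ u)) (update C i 0) (update D i 1) Seen
    drop-twin twins seen-u with witness seen-u
    ... | a , a<u , a-alive , a-class = record
      { class-reset = reset
      ; class-todo = todo
      ; alive-todo = λ {v} u<v → from (kill D u i≡ v) (alive-todo (<⇒≤ u<v) , earlier u<v ∘ sym)
      ; witness = λ seen-c → let (b , b<u , b-alive , b-class) = witness seen-c in
          b , m<n⇒m<1+n b<u , from (kill D u i≡ b) (b-alive , earlier b<u) , b-class
      ; seen = λ {v} v≤u v-alive → let (v-alive , v≢u) = to (kill D u i≡ v) v-alive in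
          seen (old v≤u v≢u) v-alive
      ; distinct = λ {v} {w} v≤u w≤u v-alive w-alive →
          let (v-alive , v≢u) = to (kill D u i≡ v) v-alive ; (w-alive , w≢u) = to (kill D u i≡ w) w-alive in
          distinct (old v≤u v≢u) (old w≤u w≢u) v-alive w-alive
      ; nim≡ = trans
          (remove-trueTwin G ⟦ alive? D ⟧ ⟦ alive? (update D i 1) ⟧ {a = a} {b = u}
            (earlier a<u)
            (from (∈-alive D) a-alive) (from (∈-alive D) (alive-todo ≤-refl))
            (twins a u (trans a-class Ci≡))
            (λ x → ⇔-trans (∈-alive (update D i 1)) (⇔-trans (kill D u i≡ x)
              (mk⇔ (λ (p , q) → from (∈-alive D) p , q) (λ (p , q) → to (∈-alive D) p , q)))))
          nim≡
      }
      where
      old : ∀ {v} → toℕ v < suc (toℕ u) → v ≢ u → toℕ v < toℕ u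
      old v≤u v≢u = [ id , (λ eq → contradiction eq v≢u) ]′ (≤-cases v≤u)

    keep-twin : Seen (C i) ≢ 1 →
      TrueTwinScan C₀ (suc (toℕ u)) (update C i 0) D (update Seen (C i) 1)
    keep-twin unseen = record
      { class-reset = reset
      ; class-todo = todo
      ; alive-todo = λ u<v → alive-todo (<⇒≤ u<v)
      ; witness = witness′
      ; seen = seen′
      ; distinct = distinct′
      ; nim≡ = nim≡
      }
      where
      witness′ : ∀ {c} → update Seen (C i) 1 c ≡ 1 →
        ∃[ a ] (toℕ {n} a < suc (toℕ u) × D (toℕ a) ≡ 0 × C₀ (toℕ a) ≡ c)
      witness′ {c} seen-c with c ≟ C i
      ... | yes refl = u , ≤-refl , alive-todo ≤-refl , sym Ci≡
      ... | no c≢ = let (a , a<u , rest) = witness (trans (sym (update-≢ Seen c≢)) seen-c) in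
        a , m<n⇒m<1+n a<u , rest

      other-class : ∀ {v} → toℕ v < toℕ u → D (toℕ v) ≡ 0 → C₀ (toℕ v) ≢ C i
      other-class v<u v-alive eq = unseen (subst (λ c → Seen c ≡ 1) eq (seen v<u v-alive))

      seen′ : ∀ {v} → toℕ v < suc (toℕ u) → D (toℕ v) ≡ 0 → update Seen (C i) 1 (C₀ (toℕ v)) ≡ 1
      seen′ v≤u v-alive with ≤-cases v≤u
      ... | inj₁ v<u = trans (update-≢ Seen (other-class v<u v-alive)) (seen v<u v-alive)
      ... | inj₂ refl = trans (cong (update Seen (C i) 1) (sym Ci≡)) (update-≡ Seen (C i))

      distinct′ : ∀ {v w} → toℕ v < suc (toℕ u) → toℕ w < suc (toℕ u) → D (toℕ v) ≡ 0 → D (toℕ w) ≡ 0 →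
        C₀ (toℕ v) ≡ C₀ (toℕ w) → v ≡ w
      distinct′ v≤u w≤u v-alive w-alive eq with ≤-cases v≤u | ≤-cases w≤u
      ... | inj₁ v<u | inj₁ w<u = distinct v<u w<u v-alive w-alive eq
      ... | inj₁ v<u | inj₂ refl = contradiction (trans eq (sym Ci≡)) (other-class v<u v-alive)
      ... | inj₂ refl | inj₁ w<u = contradiction (trans (sym eq) (sym Ci≡)) (other-class w<u w-alive)
      ... | inj₂ refl | inj₂ refl = refl

  drop-trueTwins-correct : ∀ {σ} → reg σ #n ≡ n →
    (∀ v w → arr σ aClass (toℕ v) ≡ arr σ aClass (toℕ w) ⇔ TrueTwins G v w) →
    (∀ (v : V) → arr σ aDead (toℕ v) ≡ 0) → (∀ c → arr σ aSeen c ≡ 0) →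
    Terminates drop-trueTwins σ (2 + 40 * total)
      (λ τ → (∀ (v : V) → arr τ aClass (toℕ v) ≡ 0) × nimAlive (arr τ aDead) ≡ nim G ×
             (∀ {v w} → arr τ aDead (toℕ v) ≡ 0 → arr τ aDead (toℕ w) ≡ 0 → TrueTwins G v w → v ≡ w))
  drop-trueTwins-correct {σ} σn class⇔ alive unseen =
    consequence
      (λ _ inv → let open TrueTwinScan inv in
          (λ v → class-reset (Fin.toℕ<n v)) , nim≡
        , λ {v} {w} v-alive w-alive twins →
            distinct (Fin.toℕ<n v) (Fin.toℕ<n w) v-alive w-alive (from (class⇔ v w) twins))
      (each-vertex 40 weight J {T = λ _ → 8} (λ v → linear< 9 0 40 (length (nbrs v)) (m≤m+n 10 30) z≤n)
        refl refl step σn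
        (record
          { class-reset = λ ()
          ; class-todo = λ _ → refl
          ; alive-todo = λ {v} _ → alive v
          ; witness = λ {c} seen-c → contradiction (trans (sym (unseen c)) seen-c) λ ()
          ; seen = λ ()
          ; distinct = λ ()
          ; nim≡ = nimAlive-all (arr σ aDead) alive }))
    where
    C₀ : ℕ → ℕ
    C₀ = arr σ aClass

    J : ℕ → List V → State → Set
    J k _ σ = TrueTwinScan C₀ k (arr σ aClass) (arr σ aDead) (arr σ aSeen)

    step : ∀ v todo {σ} → reg σ #u ≡ toℕ v → J (toℕ v) (v ∷ todo) σ →
      Terminates _ σ 8 (λ τ → ∀ m → J (suc (toℕ v)) todo (τ [ #u ≔ʳ m ]))
    step v todo σu inv = straight _
      ( (λ seen-v _ → drop-twin σu inv (λ v w → to (class⇔ v w)) (≡ᵇ-true seen-v))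
      , (λ unseen-v _ → keep-twin σu inv (≡ᵇ-false unseen-v)))

  Survivor : (C D : ℕ → ℕ) (k c : ℕ) → V → Set
  Survivor C D k c v = toℕ v < k × D (toℕ v) ≡ 0 × C (toℕ v) ≡ c

  -- The survivors of a class, with the array entries count and last that describe them.
  data Group (M : V → Set) (count last : ℕ) : Set where
    none : count ≡ 0 → (∀ v → ¬ M v) → Group M count last
    one  : ∀ a → count ≡ 1 → M a → (∀ {v} → M v → v ≡ a) → Group M count last
    two  : ∀ a b → count ≡ 2 → last ≡ toℕ b → M a → M b → a ≢ b →
           (∀ {v} → M v → v ≡ a ⊎ v ≡ b) → Group M count last

  group-cong : ∀ {M M′ count count′ last last′} → (∀ v → M v ⇔ M′ v) → count′ ≡ count → last′ ≡ last →
    Group M count last → Group M′ count′ last′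
  group-cong M⇔ refl refl (none eq empty) = none eq λ v → empty v ∘ from (M⇔ v)
  group-cong M⇔ refl refl (one a eq a∈ only) = one a eq (to (M⇔ a) a∈) (only ∘ from (M⇔ _))
  group-cong M⇔ refl refl (two a b eq last a∈ b∈ a≢b only) =
    two a b eq last (to (M⇔ a) a∈) (to (M⇔ b) b∈) a≢b (only ∘ from (M⇔ _))

  -- `D₀` marks the vertices dead before the pass. The field `alive₀` is what carries the absence of
  -- true twins over to the final survivors.
  record FalseTwinScan (C D₀ : ℕ → ℕ) (k : ℕ) (C′ D Count Last : ℕ → ℕ) : Set where
    field
      class-kept : C′ ≡ C
      alive₀     : ∀ {v : V} → D (toℕ v) ≡ 0 → D₀ (toℕ v) ≡ 0
      group      : ∀ c → Group (Survivor C D k c) (Count c) (Last c)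
      nim≡       : nimAlive D ≡ nim G

  module _ {C D₀ C′ D Count Last : ℕ → ℕ} {u : V} {i : ℕ} (i≡ : i ≡ toℕ u)
           (inv : FalseTwinScan C D₀ (toℕ u) C′ D Count Last) where
    open FalseTwinScan inv

    private
      c : ℕ
      c = C′ i

      Cu≡c : C (toℕ u) ≡ c
      Cu≡c = trans (sym (cong (λ f → f (toℕ u)) class-kept)) (cong C′ (sym i≡))

      later : ∀ {c v} → Survivor C D (toℕ u) c v → Survivor C D (suc (toℕ u)) c v
      later (v<u , rest) = m<n⇒m<1+n v<u , rest

      other-class : ∀ {c′} → c′ ≢ c → ∀ v →
        Survivor C D (toℕ u) c′ v ⇔ Survivor C D (suc (toℕ u)) c′ v
      other-class c′≢c v = mk⇔ (later {v = v}) λ (v≤u , v-alive , v-class) →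
        [ (λ v<u → v<u , v-alive , v-class)
        , (λ { refl → contradiction (trans (sym v-class) Cu≡c) c′≢c }) ]′ (≤-cases v≤u)

    skip-dead : D i ≢ 0 → FalseTwinScan C D₀ (suc (toℕ u)) C′ D Count Last
    skip-dead dead = record
      { class-kept = class-kept
      ; alive₀ = alive₀
      ; group = λ c′ → group-cong
          (λ v → mk⇔ (later {v = v}) λ (v≤u , v-alive , v-class) →
            [ (λ v<u → v<u , v-alive , v-class)
            , (λ { refl → contradiction (trans (cong D i≡) v-alive) dead }) ]′ (≤-cases v≤u))
          refl refl (group c′)
      ; nim≡ = nim≡
      }

    module _ (alive : D i ≡ 0) where

      private
        u-survives : Survivor C D (suc (toℕ u)) c u
        u-survives = ≤-refl , trans (cong D (sym i≡)) alive , Cu≡c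

        keep : ∀ {Count′ Last′} →
          (∀ {c′} → c′ ≢ c → Count′ c′ ≡ Count c′) → (∀ {c′} → c′ ≢ c → Last′ c′ ≡ Last c′) →
          Group (Survivor C D (suc (toℕ u)) c) (Count′ c) (Last′ c) →
          FalseTwinScan C D₀ (suc (toℕ u)) C′ D Count′ Last′
        keep {Count′} {Last′} Count′≡ Last′≡ group-c = record
          { class-kept = class-kept
              ; alive₀ = alive₀
          ; group = group′
          ; nim≡ = nim≡
          }
          where
          group′ : ∀ c′ → Group (Survivor C D (suc (toℕ u)) c′) (Count′ c′) (Last′ c′)
          group′ c′ with c′ ≟ c
          ... | yes refl = group-c
          ... | no c′≢c = group-cong (other-class c′≢c) (Count′≡ c′≢c) (Last′≡ c′≢c) (group c′)

      keep-first : Count c ≡ 0 → FalseTwinScan C D₀ (suc (toℕ u)) C′ D (update Count c 1) Last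
      keep-first count≡0 = keep (update-≢ Count) (λ _ → refl) group-c
        where
        group-c : Group (Survivor C D (suc (toℕ u)) c) (update Count c 1 c) (Last c)
        group-c with group c
        ... | none _ empty = one u (update-≡ Count c) u-survives λ (v≤u , rest) →
                [ (λ v<u → contradiction (v<u , rest) (empty _)) , id ]′ (≤-cases v≤u)
        ... | one _ count≡1 _ _ = contradiction (trans (sym count≡0) count≡1) λ ()
        ... | two _ _ count≡2 _ _ _ _ _ = contradiction (trans (sym count≡0) count≡2) λ ()

      keep-second : Count c ≡ 1 →
        FalseTwinScan C D₀ (suc (toℕ u)) C′ D (update Count c 2) (update Last c i)
      keep-second count≡1 = keep (update-≢ Count) (update-≢ Last) group-c
        where
        group-c : Group (Survivor C D (suc (toℕ u)) c) (update Count c 2 c) (update Last c i c)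
        group-c with group c
        ... | none count≡0 _ = contradiction (trans (sym count≡0) count≡1) λ ()
        ... | two _ _ count≡2 _ _ _ _ _ = contradiction (trans (sym count≡1) count≡2) λ ()
        ... | one a _ a∈ only =
          two a u (update-≡ Count c) (trans (update-≡ Last c) i≡) (later {v = a} a∈) u-survives (earlier (proj₁ a∈))
            λ (v≤u , rest) → [ (λ v<u → inj₁ (only (v<u , rest))) , inj₂ ]′ (≤-cases v≤u)

      -- With survivors `a` and `b` already in the class, `a` is the third twin required by
      -- `remove-falseTwins`. Other classes keep their survivors, as both victims belong to class
      -- `c`.
      drop-pair : (∀ v w → C (toℕ v) ≡ C (toℕ w) → FalseTwins G v w) → Count c ≢ 0 → Count c ≢ 1 →
        FalseTwinScan C D₀ (suc (toℕ u)) C′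
          (update (update D i 1) (Last c) 1) (update Count c 1) Last
      drop-pair twins count≢0 count≢1 with group c
      ... | none count≡0 _ = contradiction count≡0 count≢0
      ... | one _ count≡1 _ _ = contradiction count≡1 count≢1
      ... | two a b _ last≡ a∈@(a<u , a-alive , a-class) b∈@(b<u , b-alive , b-class) a≢b only = record
        { class-kept = class-kept
        ; alive₀ = λ {v} v-alive → alive₀ (proj₁ (to (alive⇔ v) v-alive))
        ; group = group′
        ; nim≡ = trans
            (remove-falseTwins G ⟦ alive? D ⟧ ⟦ alive? D′ ⟧ {a = u} {b = b} {c = a}
              (earlier b<u ∘ sym) (earlier a<u ∘ sym) (a≢b ∘ sym)
              (from (∈-alive D) (proj₁ (proj₂ u-survives)))
              (from (∈-alive D) b-alive) (from (∈-alive D) a-alive)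
              (twins a u (trans a-class (sym Cu≡c))) (twins a b (trans a-class (sym b-class)))
              (λ x → ⇔-trans (∈-alive D′) (⇔-trans (alive⇔ x)
                (mk⇔ (λ (p , q) → from (∈-alive D) p , q) (λ (p , q) → to (∈-alive D) p , q)))))
            nim≡
        }
        where
        D′ : ℕ → ℕ
        D′ = update (update D i 1) (Last c) 1

        alive⇔ : ∀ x → D′ (toℕ x) ≡ 0 ⇔ (D (toℕ x) ≡ 0 × x ≢ u × x ≢ b)
        alive⇔ x = ⇔-trans (kill (update D i 1) b last≡ x) (mk⇔
          (λ (p , x≢b) → let (q , x≢u) = to (kill D u i≡ x) p in q , x≢u , x≢b)
          (λ (q , x≢u , x≢b) → from (kill D u i≡ x) (q , x≢u) , x≢b))

        survivor⇔ : ∀ {c′} v → Survivor C D′ (suc (toℕ u)) c′ v ⇔ (Survivor C D (toℕ u) c′ v × v ≢ b)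
        survivor⇔ v = mk⇔
          (λ (v≤u , v-alive , v-class) → let (v-alive , v≢u , v≢b) = to (alive⇔ v) v-alive in
            ([ id , (λ eq → contradiction eq v≢u) ]′ (≤-cases v≤u) , v-alive , v-class) , v≢b)
          (λ ((v<u , v-alive , v-class) , v≢b) →
            m<n⇒m<1+n v<u , from (alive⇔ v) (v-alive , earlier v<u , v≢b) , v-class)

        group′ : ∀ c′ → Group (Survivor C D′ (suc (toℕ u)) c′) (update Count c 1 c′) (Last c′)
        group′ c′ with c′ ≟ c
        ... | yes refl = one a (update-≡ Count c) (from (survivor⇔ a) (a∈ , a≢b)) λ {v} v∈ →
                let (v∈ , v≢b) = to (survivor⇔ v) v∈ in
                [ id , (λ eq → contradiction eq v≢b) ]′ (only v∈)
        ... | no c′≢c = group-cong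
                (λ v → mk⇔
                  (λ v∈ → from (survivor⇔ v) (v∈ , λ { refl → c′≢c (trans (sym (proj₂ (proj₂ v∈))) b-class) }))
                  (proj₁ ∘ to (survivor⇔ v)))
                (update-≢ Count c′≢c) refl (group c′)

  no-three : ∀ {M count last x y z} → Group M count last → M x → M y → M z → x ≡ y ⊎ x ≡ z ⊎ y ≡ z
  no-three (none _ empty) x∈ _ _ = contradiction x∈ (empty _)
  no-three (one _ _ _ only) x∈ y∈ _ = inj₁ (trans (only x∈) (sym (only y∈)))
  no-three (two _ _ _ _ _ _ _ only) x∈ y∈ z∈ with only x∈ | only y∈ | only z∈
  ... | inj₁ refl | inj₁ refl | _ = inj₁ refl
  ... | inj₁ refl | inj₂ _ | inj₁ refl = inj₂ (inj₁ refl)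
  ... | inj₁ _ | inj₂ refl | inj₂ refl = inj₂ (inj₂ refl)
  ... | inj₂ refl | inj₂ refl | _ = inj₁ refl
  ... | inj₂ refl | inj₁ _ | inj₂ refl = inj₂ (inj₁ refl)
  ... | inj₂ _ | inj₁ refl | inj₁ refl = inj₂ (inj₂ refl)

  drop-falseTwins-correct : ∀ {σ} → reg σ #n ≡ n →
    (∀ v w → arr σ aClass (toℕ v) ≡ arr σ aClass (toℕ w) ⇔ FalseTwins G v w) →
    nimAlive (arr σ aDead) ≡ nim G → (∀ c → arr σ aCount c ≡ 0) →
    Terminates drop-falseTwins σ (2 + 40 * total)
      (λ τ → nimAlive (arr τ aDead) ≡ nim G ×
             (∀ {v : V} → arr τ aDead (toℕ v) ≡ 0 → arr σ aDead (toℕ v) ≡ 0) ×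
             (∀ {x y z} → arr τ aDead (toℕ x) ≡ 0 → arr τ aDead (toℕ y) ≡ 0 → arr τ aDead (toℕ z) ≡ 0 →
               FalseTwins G x y → FalseTwins G x z → x ≡ y ⊎ x ≡ z ⊎ y ≡ z))
  drop-falseTwins-correct {σ} σn class⇔ nim-σ count≡0 =
    consequence
      (λ _ inv → let open FalseTwinScan inv in
          nim≡ , alive₀
        , λ {x} {y} {z} x-alive y-alive z-alive xy xz → no-three (group (C (toℕ x)))
            (Fin.toℕ<n x , x-alive , refl)
            (Fin.toℕ<n y , y-alive , sym (from (class⇔ x y) xy))
            (Fin.toℕ<n z , z-alive , sym (from (class⇔ x z) xz)))
      (each-vertex 40 weight J {T = λ _ → 17} (λ v → linear< 18 0 40 (length (nbrs v)) (m≤m+n 19 21) z≤n)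
        refl refl step σn
        (record
          { class-kept = refl
          ; alive₀ = id
          ; group = λ c → none (count≡0 c) λ { _ (() , _) }
          ; nim≡ = nim-σ }))
    where
    C : ℕ → ℕ
    C = arr σ aClass

    J : ℕ → List V → State → Set
    J k _ ρ = FalseTwinScan C (arr σ aDead) k (arr ρ aClass) (arr ρ aDead) (arr ρ aCount) (arr ρ aLast)

    step : ∀ v todo {σ} → reg σ #u ≡ toℕ v → J (toℕ v) (v ∷ todo) σ →
      Terminates _ σ 17 (λ τ → ∀ m → J (suc (toℕ v)) todo (τ [ #u ≔ʳ m ]))
    step v todo σu inv = straight _
      ( (λ alive →
          (λ first _ → keep-first σu inv (≡ᵇ-true alive) (≡ᵇ-true first))
        , λ not-first →
            (λ second _ → keep-second σu inv (≡ᵇ-true alive) (≡ᵇ-true second))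
          , λ not-second _ → drop-pair σu inv (≡ᵇ-true alive) (λ v w → to (class⇔ v w))
              (≡ᵇ-false not-first) (≡ᵇ-false not-second))
      , λ dead _ → skip-dead σu inv (≡ᵇ-false dead))

  -- Numbering the survivors and writing their graph

  rank : (ℕ → ℕ) → ℕ → ℕ
  rank D zero = 0
  rank D (suc k) = if D k ≡ᵇ 0 then suc (rank D k) else rank D k

  rank-alive : ∀ D {k} → D k ≡ 0 → rank D (suc k) ≡ suc (rank D k)
  rank-alive D eq rewrite eq = refl

  rank-dead : ∀ D {k} → D k ≢ 0 → rank D (suc k) ≡ rank D k
  rank-dead D dead rewrite ≢⇒≡ᵇ dead = refl

  -- Any function that steps up exactly at the members of `P` enumerates them in order. Starting
  -- from an arbitrary `k` makes the induction along the list possible.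
  numbering : ∀ {P : V → Set} (P? : U.Decidable P) (r : ℕ → ℕ) →
    (∀ {v} → P v → r (suc (toℕ v)) ≡ suc (r (toℕ v))) → (∀ {v} → ¬ P v → r (suc (toℕ v)) ≡ r (toℕ v)) →
    ∀ {k} vs → Counting k vs →
    r n ≡ r k + length (filter P? vs) × ∀ i → r (toℕ (lookup (filter P? vs) i)) ≡ r k + toℕ i
  numbering P? r hit miss [] refl = sym (+-identityʳ _) , λ ()
  numbering P? r hit miss (v ∷ vs) (refl , count) with P? v | numbering P? r hit miss vs count
  ... | no ¬Pv | rn , rest rewrite miss ¬Pv = rn , rest
  ... | yes Pv | rn , rest rewrite hit Pv =
      trans rn (sym (+-suc _ _))
    , λ { Fin.zero → sym (+-identityʳ _) ; (Fin.suc i) → trans (rest i) (sym (+-suc _ _)) }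

  module _ (D : ℕ → ℕ) where
    open Induced G (alive? D)

    rank-vertices : rank D n ≡ length vertices × (∀ i → rank D (toℕ (lookup vertices i)) ≡ toℕ i)
    rank-vertices = numbering (alive? D) (rank D) (rank-alive D) (rank-dead D) (allFin n) (counting-allFin n)

  renumber-correct : ∀ {σ} → reg σ #n ≡ n →
    Terminates renumber σ (3 + 40 * total)
      (λ τ → reg τ #q ≡ rank (arr σ aDead) n ×
             (∀ (v : V) → arr τ aId (toℕ v) ≡ rank (arr σ aDead) (toℕ v)))
  renumber-correct {σ} σn =
    straight (#q ≔ 0) {Φ = _≡ σ [ #q ≔ʳ 0 ]} refl ⨟ λ { _ refl →
    consequence (λ _ (q≡ , id≡ , _) → q≡ , λ v → id≡ v (Fin.toℕ<n v))
      (each-vertex 40 weight J {T = λ _ → 6} (λ v → linear< 7 0 40 (length (nbrs v)) (m≤m+n 8 32) z≤n)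
        refl refl step σn (refl , (λ _ ()) , refl)) }
    where
    D : ℕ → ℕ
    D = arr σ aDead

    J : ℕ → List V → State → Set
    J k _ ρ = reg ρ #q ≡ rank D k × (∀ (v : V) → toℕ v < k → arr ρ aId (toℕ v) ≡ rank D (toℕ v)) ×
              arr ρ aDead ≡ D

    step : ∀ v todo {σ} → reg σ #u ≡ toℕ v → J (toℕ v) (v ∷ todo) σ →
      Terminates _ σ 6 (λ τ → ∀ m → J (suc (toℕ v)) todo (τ [ #u ≔ʳ m ]))
    step v todo {σ} σu (q≡ , id≡ , D≡) = straight _
      ( (λ alive _ →
            trans (cong suc q≡) (sym (rank-alive D (trans (sym Du≡) (≡ᵇ-true alive)))) , id≡′ , D≡)
      , λ dead _ →
            trans q≡ (sym (rank-dead D λ eq → ≡ᵇ-false dead (trans Du≡ eq))) , id≡′ , D≡)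
      where
      Du≡ : arr σ aDead (reg σ #u) ≡ D (toℕ v)
      Du≡ = trans (cong (λ f → f (reg σ #u)) D≡) (cong D σu)

      id≡′ : ∀ (w : V) → toℕ w < suc (toℕ v) →
        update (arr σ aId) (reg σ #u) (reg σ #q) (toℕ w) ≡ rank D (toℕ w)
      id≡′ w w≤v with ≤-cases w≤v
      ... | inj₁ w<v = trans (update-≢ (arr σ aId) λ eq → <⇒≢ w<v (trans eq σu)) (id≡ w w<v)
      ... | inj₂ refl rewrite σu = trans (update-≡ (arr σ aId) (toℕ w)) q≡

  skip-block-correct : ∀ {σ rest} (ws : List V) → reg σ #0 ≡ 0 → reg σ #deg ≡ length ws →
    Stream (arr σ aIn) (reg σ #p) (map toℕ ws ++ rest) →
    Terminates skip-block σ (suc (20 * length ws)) (λ τ → Stream (arr τ aIn) (reg τ #p) rest)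
  skip-block-correct {σ} {rest} ws zero≡ deg≡ str =
    loosen (≤-reflexive (cong (λ m → suc (20 * m)) (sum-ones ws)))
      (consequence (λ _ → proj₁)
        (for-each I 20 (λ _ → 1) {T = λ _ → 2} (λ _ → m≤m+n 3 17) (λ {d} → exit {d}) (λ {d} → body {d})
          {done = []} ws (str , zero≡ , deg≡)))
    where
    I : List V → List V → State → Set
    I _ todo σ = Stream (arr σ aIn) (reg σ #p) (map toℕ todo ++ rest) ×
      reg σ #0 ≡ 0 × reg σ #deg ≡ length todo

    exit : ∀ {done} σ → I done [] σ → test (#0 ≺ #deg) σ ≡ false
    exit σ (_ , zero≡ , deg≡) rewrite zero≡ | deg≡ = refl

    body : ∀ {done w todo} σ → I done (w ∷ todo) σ → test (#0 ≺ #deg) σ ≡ true ×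
      Terminates (inc #p ⨾ dec #deg) σ 2 (I (w ∷ done) todo)
    body {w = w} σ (str , zero≡ , deg≡) =
        <ᵇ-true (subst (_< reg σ #deg) (sym zero≡) (subst (0 <_) (sym deg≡) (s≤s z≤n)))
      , straight (inc #p ⨾ dec #deg)
          (stream-tail (arr σ aIn) (reg σ #p) {x = toℕ w} str , zero≡ , cong pred deg≡)

  module _ (D Id : ℕ → ℕ) where

    alives : List V → List V
    alives = filter (alive? D)

    ids : List V → List ℕ
    ids = map (Id ∘ toℕ) ∘ alives

    out : V → List ℕ
    out v = length (alives (nbrs v)) ∷ ids (nbrs v)

    scan-output-correct : ∀ {σ rest pre₀} ws → arr σ aDead ≡ D → arr σ aId ≡ Id →
      reg σ #0 ≡ 0 → reg σ #deg ≡ length ws → reg σ #d ≡ 0 →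
      Stream (arr σ aIn) (reg σ #p) (map toℕ ws ++ rest) →
      Holds (arr σ aOut) pre₀ → reg σ #q ≡ length pre₀ →
      Terminates scan-output σ (suc (20 * length ws))
        (λ τ → Holds (arr τ aOut) (pre₀ ++ ids ws) × reg τ #q ≡ length (pre₀ ++ ids ws) ×
               reg τ #d ≡ length (alives ws) × Stream (arr τ aIn) (reg τ #p) rest)
    scan-output-correct {σ} {rest} {pre₀} ws dead≡ id≡ zero≡ deg≡ d≡ str holds q≡ =
      loosen (≤-reflexive (cong (λ m → suc (20 * m)) (sum-ones ws)))
        (consequence (λ {τ} _ → finish τ)
          (for-each I 20 (λ _ → 1) {T = λ _ → 10} (λ _ → m≤m+n 11 9) (λ {d} → exit {d}) (λ {d} → body {d})
            {done = []} ws (dead≡ , id≡ , zero≡ , deg≡ , str ,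
              pre₀ , refl , holds , q≡ , cong (_+ length (alives ws)) d≡)))
      where
      -- The text written so far followed by the text still due is constant; this avoids any
      -- statement about the reversed list of processed vertices.
      I : List V → List V → State → Set
      I _ todo σ = arr σ aDead ≡ D × arr σ aId ≡ Id × reg σ #0 ≡ 0 × reg σ #deg ≡ length todo ×
        Stream (arr σ aIn) (reg σ #p) (map toℕ todo ++ rest) ×
        ∃[ pre ] (pre ++ ids todo ≡ pre₀ ++ ids ws × Holds (arr σ aOut) pre × reg σ #q ≡ length pre ×
                  reg σ #d + length (alives todo) ≡ length (alives ws))

      finish : ∀ τ → I [] [] τ →
        Holds (arr τ aOut) (pre₀ ++ ids ws) × reg τ #q ≡ length (pre₀ ++ ids ws) ×
        reg τ #d ≡ length (alives ws) × Stream (arr τ aIn) (reg τ #p) rest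
      finish τ (_ , _ , _ , _ , str , pre , pre≡ , holds , q≡ , d≡) =
          subst (Holds (arr τ aOut)) pre≡′ holds , trans q≡ (cong length pre≡′)
        , trans (sym (+-identityʳ _)) d≡ , str
        where
        pre≡′ : pre ≡ pre₀ ++ ids ws
        pre≡′ = trans (sym (++-identityʳ pre)) pre≡

      exit : ∀ {done} σ → I done [] σ → test (#0 ≺ #deg) σ ≡ false
      exit σ (_ , _ , zero≡ , deg≡ , _) rewrite zero≡ | deg≡ = refl

      body : ∀ {done w todo} σ → I done (w ∷ todo) σ → test (#0 ≺ #deg) σ ≡ true ×
        Terminates _ σ 10 (I (w ∷ done) todo)
      body {w = w} {todo} σ (dead≡ , id≡ , zero≡ , deg≡ , str , pre , pre≡ , holds , q≡ , d≡) =
          <ᵇ-true (subst (_< reg σ #deg) (sym zero≡) (subst (0 <_) (sym deg≡) (s≤s z≤n)))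
        , straight _
            ( (λ alive → let keep = filter-accept (alive? D) {xs = todo} (trans (sym Dw≡) (trans (≡ᵇ-true alive) zero≡)) in
                dead≡ , id≡ , zero≡ , cong pred deg≡ , stream-tail (arr σ aIn) (reg σ #p) str
              , pre ++ newId ∷ []
              , trans (++-assoc pre (newId ∷ []) (ids todo))
                  (trans (cong (λ x → pre ++ x ∷ ids todo) newId≡)
                    (trans (cong (λ xs → pre ++ map (Id ∘ toℕ) xs) (sym keep)) pre≡))
              , holds-append {xs = pre} holds q≡
              , trans (cong suc q≡) (sym (trans (length-++ pre) (+-comm (length pre) 1)))
              , trans (sym (+-suc (reg σ #d) _)) (trans (cong (λ xs → reg σ #d + length xs) (sym keep)) d≡))
            , (λ dead → let drop = filter-reject (alive? D) {xs = todo} (λ eq → ≡ᵇ-false dead (trans Dw≡ (trans eq (sym zero≡)))) in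
                dead≡ , id≡ , zero≡ , cong pred deg≡ , stream-tail (arr σ aIn) (reg σ #p) str
              , pre
              , trans (cong (λ xs → pre ++ map (Id ∘ toℕ) xs) (sym drop)) pre≡
              , holds , q≡ , trans (cong (λ xs → reg σ #d + length xs) (sym drop)) d≡))
        where
        newId : ℕ
        newId = arr σ aId (arr σ aIn (reg σ #p))

        w≡ : arr σ aIn (reg σ #p) ≡ toℕ w
        w≡ = stream-head (arr σ aIn) (reg σ #p) str

        newId≡ : newId ≡ Id (toℕ w)
        newId≡ = trans (cong (λ f → f (arr σ aIn (reg σ #p))) id≡) (cong Id w≡)

        Dw≡ : arr σ aDead (arr σ aIn (reg σ #p)) ≡ D (toℕ w)
        Dw≡ = trans (cong (λ f → f (arr σ aIn (reg σ #p))) dead≡) (cong D w≡)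

    output-correct : ∀ {σ} → Input σ → arr σ aDead ≡ D → arr σ aId ≡ Id → (∀ i → arr σ aOut i ≡ 0) →
      Terminates output σ (6 + 40 * total)
        (λ τ → Holds (arr τ aOut) (reg σ #q ∷ concatMap out (alives (allFin n))))
    output-correct {σ₀} (str , σn) dead≡ id≡ empty =
      straight (#0 ≔ 0 ⨾ aOut ⟨ #0 ⟩← #q ⨾ #q ≔ 1 ⨾ #p ≔ 1)
        {Φ = _≡ (((σ₀ [ #0 ≔ʳ 0 ]) [ aOut , 0 ≔ᵃ reg σ₀ #q ]) [ #q ≔ʳ 1 ]) [ #p ≔ʳ 1 ]} refl
      ⨟ λ { _ refl → consequence (λ {τ} _ → finish τ)
        (each-vertex 40 weight J {T = T} T< refl refl step σn
          (dead≡ , id≡ , str , reg σ₀ #q ∷ [] , refl , holds-append {xs = []} empty refl , refl)) }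
      where
      result : List ℕ
      result = reg σ₀ #q ∷ concatMap out (alives (allFin n))

      J : ℕ → List V → State → Set
      J _ todo σ = arr σ aDead ≡ D × arr σ aId ≡ Id ×
        Stream (arr σ aIn) (reg σ #p) (concatMap code todo) ×
        ∃[ pre ] (pre ++ concatMap out (alives todo) ≡ result × Holds (arr σ aOut) pre × reg σ #q ≡ length pre)

      finish : ∀ τ → J n [] τ → Holds (arr τ aOut) result
      finish τ (_ , _ , _ , pre , pre≡ , holds , _) =
        subst (Holds (arr τ aOut)) (trans (sym (++-identityʳ pre)) pre≡) holds

      T : V → ℕ
      T v = 10 + 20 * length (nbrs v)

      T< : ∀ v → suc (T v) < 40 * weight v
      T< v = linear< 11 20 40 (length (nbrs v)) (m≤m+n 12 28) (m≤m+n 20 20)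

      step : ∀ v todo {σ} → reg σ #u ≡ toℕ v → J (toℕ v) (v ∷ todo) σ →
        Terminates _ σ (T v) (λ τ → ∀ m → J (suc (toℕ v)) todo (τ [ #u ≔ʳ m ]))
      step v todo {σ} σu (dead≡ , id≡ , str , pre , pre≡ , holds , q≡) =
        straight (#0 ≔ 0 ⨾ #deg ← aIn ⟨ #p ⟩ ⨾ inc #p ⨾ #t ← aDead ⟨ #u ⟩)
          {Φ = _≡ (((σ [ #0 ≔ʳ 0 ]) [ #deg ≔ʳ arr σ aIn (reg σ #p) ]) [ #p ≔ʳ suc (reg σ #p) ])
                     [ #t ≔ʳ arr σ aDead (reg σ #u) ]} refl ⨟ λ { _ refl →
        branch
          (λ alive →
            let keep = filter-accept (alive? D) {xs = todo} (trans (sym Du≡) (≡ᵇ-true alive)) in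
            loosen (≤-reflexive (cong (3 +_) (+-comm (suc (20 * length (nbrs v))) 1)))
            (straight (#slot ← #q ⨾ inc #q ⨾ #d ≔ 0) {Φ = _≡ emitting} refl ⨟ λ { _ refl →
             -- The trailing 0 is the cell at `#slot`, reserved for the new degree and overwritten
             -- once `#d` is final.
             scan-output-correct {pre₀ = pre ++ 0 ∷ []} (nbrs v) dead≡ id≡ refl (stream-head (arr σ aIn) (reg σ #p) str) refl
               (stream-tail (arr σ aIn) (reg σ #p) str) (holds-append-0 {xs = pre} holds)
               (trans (cong suc q≡) (sym (trans (length-++ pre {0 ∷ []}) (+-comm (length pre) 1))))
             ⨟ λ { {ρ} frame (holds′ , q≡′ , d≡′ , str′) →
             straight (aOut ⟨ #slot ⟩← #d) λ m →
                 trans (arrs frame aDead refl) dead≡ , trans (arrs frame aId refl) id≡ , str′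
               , pre ++ reg ρ #d ∷ ids (nbrs v)
               , trans (++-assoc pre (reg ρ #d ∷ ids (nbrs v)) (concatMap out (alives todo)))
                   (trans (cong (λ d → pre ++ d ∷ ids (nbrs v) ++ concatMap out (alives todo)) d≡′)
                     (trans (cong (λ vs → pre ++ concatMap out vs) (sym keep)) pre≡))
               , holds-replace pre {x = 0}
                   (subst (Holds (arr ρ aOut)) (++-assoc pre (0 ∷ []) (ids (nbrs v))) holds′)
                   (trans (regs frame #slot refl) q≡)
               , trans q≡′ (trans (cong length (++-assoc pre (0 ∷ []) (ids (nbrs v))))
                   (trans (length-++ pre {0 ∷ ids (nbrs v)}) (sym (length-++ pre {reg ρ #d ∷ ids (nbrs v)})))) } }))
          (λ dead →
            let drop = filter-reject (alive? D) {xs = todo} (λ eq → ≡ᵇ-false dead (trans Du≡ eq)) in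
            loosen (m≤n+m (suc (20 * length (nbrs v))) 4)
            (consequence
              (λ {ρ} frame str′ m →
                  trans (arrs frame aDead refl) dead≡ , trans (arrs frame aId refl) id≡ , str′
                , pre , trans (cong (λ vs → pre ++ concatMap out vs) (sym drop)) pre≡
                , subst (λ a → Holds a pre) (sym (arrs frame aOut refl)) holds
                , trans (regs frame #q refl) q≡)
              (skip-block-correct (nbrs v) refl (stream-head (arr σ aIn) (reg σ #p) str)
                (stream-tail (arr σ aIn) (reg σ #p) str)))) }
        where
        entering emitting : State
        entering = (((σ [ #0 ≔ʳ 0 ]) [ #deg ≔ʳ arr σ aIn (reg σ #p) ]) [ #p ≔ʳ suc (reg σ #p) ])
                     [ #t ≔ʳ arr σ aDead (reg σ #u) ]
        emitting = ((entering [ #slot ≔ʳ reg σ #q ]) [ #q ≔ʳ suc (reg σ #q) ]) [ #d ≔ʳ 0 ]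

        Du≡ : arr σ aDead (reg σ #u) ≡ D (toℕ v)
        Du≡ = trans (cong (λ f → f (reg σ #u)) dead≡) (cong D σu)

  -- The complete run and its time

  record Kernelized (τ : State) : Set where
    field
      dead newId   : ℕ → ℕ
      nim-alive    : nimAlive dead ≡ nim G
      no-trueTwins : ∀ {v w : V} → dead (toℕ v) ≡ 0 → dead (toℕ w) ≡ 0 → TrueTwins G v w → v ≡ w
      no-three-falseTwins : ∀ {x y z : V} → dead (toℕ x) ≡ 0 → dead (toℕ y) ≡ 0 → dead (toℕ z) ≡ 0 →
        FalseTwins G x y → FalseTwins G x z → x ≡ y ⊎ x ≡ z ⊎ y ≡ z
      newId≡rank   : ∀ (v : V) → newId (toℕ v) ≡ rank dead (toℕ v)
      output-holds : Holds (arr τ aOut)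
        (rank dead n ∷ concatMap (out dead newId) (filter (alive? dead) (allFin n)))

  kernelize-correct : Terminates kernelize (initial (n ∷ concatMap code (allFin n)))
    (2 + ((5 + 40 * total) + ((2 + 40 * total) + ((5 + 40 * total) +
      ((2 + 40 * total) + ((3 + 40 * total) + (6 + 40 * total)))))))
    Kernelized
  kernelize-correct =
    straight (#0 ≔ 0 ⨾ #n ← aIn ⟨ #0 ⟩) {Φ = _≡ σ} refl ⨟ λ { _ refl →
    refine-correct true {σ} ((λ _ → refl) , refl) (λ _ → refl) (λ _ → z≤n)
    ⨟ λ {σ₁} fr₁ part₁ →
    let n₁ = regs fr₁ #n refl in
    drop-trueTwins-correct n₁
      (λ v w → ⇔-trans (Partition.class⇔ part₁ v w) (⇔-sym (trueTwins⇔Agree v w)))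
      (λ v → cong (λ f → f (toℕ v)) (arrs fr₁ aDead refl))
      (λ c → cong (λ f → f c) (arrs fr₁ aSeen refl))
    ⨟ λ {σ₂} fr₂ (class≡0 , nim₂ , no-true) →
    let n₂ = trans (regs fr₂ #n refl) n₁
        in₂ = trans (arrs fr₂ aIn refl) (arrs fr₁ aIn refl) in
    -- The stamps of the first refinement stay in place. Deleting true twins changes neither them
    -- nor `#s`, so they are still bounded by `#s`.
    refine-correct false {σ₂} ((λ i → cong (λ f → f (suc i)) in₂) , n₂) class≡0
      (λ c → subst (_≤ reg σ₂ #s) (sym (cong (λ f → f c) (arrs fr₂ aStamp refl)))
               (subst (arr σ₁ aStamp c ≤_) (sym (regs fr₂ #s refl)) (Partition.stamp≤ part₁ c)))
    ⨟ λ {σ₃} fr₃ part₃ →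
    let n₃ = trans (regs fr₃ #n refl) n₂ in
    drop-falseTwins-correct n₃
      (λ v w → ⇔-trans (Partition.class⇔ part₃ v w) (⇔-sym (falseTwins⇔Agree v w)))
      (trans (cong nimAlive (arrs fr₃ aDead refl)) nim₂)
      (λ c → cong (λ f → f c)
        (trans (arrs fr₃ aCount refl) (trans (arrs fr₂ aCount refl) (arrs fr₁ aCount refl))))
    ⨟ λ {σ₄} fr₄ (nim₄ , alive₄ , no-false) →
    let n₄ = trans (regs fr₄ #n refl) n₃ in
    renumber-correct n₄
    ⨟ λ {σ₅} fr₅ (q≡ , id≡) →
    let n₅ = trans (regs fr₅ #n refl) n₄
        in₅ = trans (arrs fr₅ aIn refl) (trans (arrs fr₄ aIn refl) (trans (arrs fr₃ aIn refl) in₂))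
        out₅ = trans (arrs fr₅ aOut refl) (trans (arrs fr₄ aOut refl) (trans (arrs fr₃ aOut refl)
                 (trans (arrs fr₂ aOut refl) (arrs fr₁ aOut refl))))
        alive₂ : ∀ {v : V} → arr σ₄ aDead (toℕ v) ≡ 0 → arr σ₂ aDead (toℕ v) ≡ 0
        alive₂ = λ {v} v-alive → trans (sym (cong (λ f → f (toℕ v)) (arrs fr₃ aDead refl))) (alive₄ v-alive)
    in
    consequence
      (λ {τ} _ holds → record
        { dead = arr σ₄ aDead
        ; newId = arr σ₅ aId
        ; nim-alive = nim₄
        ; no-trueTwins = λ v-alive w-alive → no-true (alive₂ v-alive) (alive₂ w-alive)
        ; no-three-falseTwins = no-false
        ; newId≡rank = id≡
        ; output-holds = subst (λ k → Holds (arr τ aOut)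
            (k ∷ concatMap (out (arr σ₄ aDead) (arr σ₅ aId)) (filter (alive? (arr σ₄ aDead)) (allFin n)))) q≡ holds
        })
      (output-correct (arr σ₄ aDead) (arr σ₅ aId)
        ((λ i → cong (λ f → f (suc i)) in₅) , n₅) (arrs fr₅ aDead refl) refl
        (λ i → cong (λ f → f i) out₅)) }
    where
    σ : State
    σ = (initial (n ∷ concatMap code (allFin n)) [ #0 ≔ʳ 0 ]) [ #n ≔ʳ n ]

  total≤ : total ≤ 2 * size
  total≤ = begin
    total                                                       ≡⟨ sum-suc (allFin n) ⟩
    length (allFin n) + sum (map (length ∘ nbrs) (allFin n))    ≤⟨ +-mono-≤ (≤-reflexive (length-tabulate {n = n} id))
                                                                              (sum-degrees≤ G nbrs nbrs! nbrs⇔) ⟩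
    n + (length edges + length edges)                           ≡⟨ +-assoc n (length edges) (length edges) ⟨
    (n + length edges) + length edges                           ≤⟨ +-monoʳ-≤ size (m≤n+m (length edges) n) ⟩
    size + size                                                 ≡⟨ cong (size +_) (+-identityʳ size) ⟨
    2 * size                                                    ∎
    where
    open ≤-Reasoning

    sum-suc : ∀ vs → sum (map weight vs) ≡ length vs + sum (map (length ∘ nbrs) vs)
    sum-suc [] = refl
    sum-suc (v ∷ vs) = cong suc (trans (cong (length (nbrs v) +_) (sum-suc vs))
      (trans (sym (+-assoc (length (nbrs v)) (length vs) _))
        (trans (cong (_+ sum (map (length ∘ nbrs) vs)) (+-comm (length (nbrs v)) (length vs)))
          (+-assoc (length vs) (length (nbrs v)) _))))

-- Six passes at rate 40, with `total` at most twice the size, give 6 · 40 · 2 = 480. The remaining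
-- 25 steps are padded to 480 because slope and summand must be the same constant.
time-bound : ∀ total size → total ≤ 2 * size →
  2 + ((5 + 40 * total) + ((2 + 40 * total) + ((5 + 40 * total) +
    ((2 + 40 * total) + ((3 + 40 * total) + (6 + 40 * total)))))) ≤ 480 * size + 480
time-bound total size total≤ = begin
  2 + ((5 + a) + ((2 + a) + ((5 + a) + ((2 + a) + ((3 + a) + (6 + a))))))
    ≡⟨ solve 1 (λ a → con 2 :+ ((con 5 :+ a) :+ ((con 2 :+ a) :+ ((con 5 :+ a) :+ ((con 2 :+ a) :+
         ((con 3 :+ a) :+ (con 6 :+ a)))))) := con 6 :* a :+ con 25) refl a ⟩
  6 * a + 25             ≤⟨ +-mono-≤ (*-monoʳ-≤ 6 (*-monoʳ-≤ 40 total≤)) (m≤m+n 25 455) ⟩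
  6 * (40 * (2 * size)) + 480 ≡⟨ cong (_+ 480) (trans (sym (*-assoc 6 40 (2 * size))) (sym (*-assoc 240 2 size))) ⟩
  480 * size + 480       ∎
  where
  open ≤-Reasoning
  open +-*-Solver
  a : ℕ
  a = 40 * total

-- Kernel and polynomial kernelization

IsKernel : Graph → Graph → Set
IsKernel G H = nim G ≡ nim H × Graph.order H ≤ 2 * nd G

-- T is a variable because matching on the run normalises the goal, and the numeral 480 would
-- then be unfolded in unary.
kernel-of : ∀ G nbrs nbrs! nbrs⇔ {P T} → let open Kernelization G nbrs nbrs! nbrs⇔ in
  Terminates P (initial (Graph.order G ∷ concatMap code (allFin (Graph.order G)))) T Kernelized →
  ∃[ H ] ∃[ ys ] (IsKernel G H × ys Encodes H ×
    P on (Graph.order G ∷ concatMap code (allFin (Graph.order G))) yields ys within T)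
kernel-of G nbrs nbrs! nbrs⇔ (halts {t} {τ} t≤ run result) =
    induced , length vertices ∷ concatMap (out dead newId) vertices
  , ( trans (sym nim-alive) (sym nim-induced)
    , order-induced≤ no-trueTwins no-three-falseTwins)
  , induced-encoding nbrs nbrs! nbrs⇔ (newId ∘ toℕ)
      (λ i → trans (newId≡rank (lookup vertices i)) (proj₂ (rank-vertices dead) i))
  , t , τ , t≤ , run
  , holds⇒HasOutput {τ} (length vertices ∷ concatMap (out dead newId) vertices)
      (subst (λ k → Holds (arr τ aOut) (k ∷ concatMap (out dead newId) vertices))
        (proj₁ (rank-vertices dead)) output-holds)
  where
  open Kernelization G nbrs nbrs! nbrs⇔
  open Kernelized result
  open Induced G (alive? dead)

kernelize-computes : kernelize Computes IsKernel Within λ G → 480 * Graph.size G + 480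
kernelize-computes G _ (nbrs , nbrs! , nbrs⇔ , refl) =
  kernel-of G nbrs nbrs! nbrs⇔ (loosen (time-bound total (Graph.size G) total≤) kernelize-correct)
  where open Kernelization G nbrs nbrs! nbrs⇔

encode : ∀ G → ∃[ xs ] xs Encodes G
encode G = _ , (λ v → filter (adj? v) (allFin order))
  , (λ v → Unique.filter⁺ (adj? v) (Unique.allFin⁺ order))
  , (λ v w → mk⇔ (λ w∈ → proj₂ (∈-filter⁻ (adj? v) {xs = allFin order} w∈)) (λ vw → ∈-filter⁺ (adj? v) (∈-allFin w) vw))
  , refl
  where open Graph G

-- Vertices and new parameter contribute at most 2k each, the latter through the partition into
-- singletons, and edges at most (2k)². The linear part 4k is absorbed by k ≤ k².
kernel-size≤ : ∀ G H → Graph.order H ≤ 2 * nd G → Graph.size H + nd H ≤ 8 * nd G ^ 2 + 8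
kernel-size≤ G H n≤2k = begin
  (n + length (Graph.edges H)) + nd H ≤⟨ +-mono-≤ (+-monoʳ-≤ n (length-edges≤ H)) (nd≤order H) ⟩
  (n + n * n) + n                     ≤⟨ +-mono-≤ (+-mono-≤ n≤2k (*-mono-≤ n≤2k n≤2k)) n≤2k ⟩
  (2 * k + 2 * k * (2 * k)) + 2 * k   ≡⟨ solve 1 (λ k → (con 2 :* k :+ con 2 :* k :* (con 2 :* k)) :+ con 2 :* k
                                           := con 4 :* k :+ con 4 :* (k :* (k :* con 1))) refl k ⟩
  4 * k + 4 * k ^ 2                   ≤⟨ +-monoˡ-≤ (4 * k ^ 2) (*-monoʳ-≤ 4 (k≤k² k)) ⟩
  4 * k ^ 2 + 4 * k ^ 2               ≡⟨ *-distribʳ-+ (k ^ 2) 4 4 ⟨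
  8 * k ^ 2                           ≤⟨ m≤m+n (8 * k ^ 2) 8 ⟩
  8 * k ^ 2 + 8                       ∎
  where
  open ≤-Reasoning
  open +-*-Solver
  n k : ℕ
  n = Graph.order H
  k = nd G

  k≤k² : ∀ k → k ≤ k ^ 2
  k≤k² zero = z≤n
  k≤k² (suc k) = m≤m*n (suc k) (suc k ^ 1)

mainTheorem4 : (∀ G → ∃[ H ] (nim G ≡ nim H × Graph.order H ≤ 2 * nd G)) ×
    (∃[ P ]
    ((P ComputesInLinearTime λ G H → nim G ≡ nim H × Graph.order H ≤ 2 * nd G) ×
    (P IsPolynomialKernelizationOf NodeKayles By nd)))
mainTheorem4 =
    -- Existence is read off from a run of the program on some encoding of `G`.
    (λ G → let (xs , enc) = encode G ; (H , _ , kernel , _) = kernelize-computes G xs enc in H , kernel)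
  , kernelize
  , (480 , kernelize-computes)
  -- Constant and exponent of the kernel size, then of the running time, where linear time is viewed
  -- as polynomial time of degree 1.
  , 8 , 2 , 480 , 1 , λ G xs enc →
      let (H , ys , (nim≡ , order≤) , enc′ , t , τ , t≤ , run , out) = kernelize-computes G xs enc in
      H , ys , (NodeKayles-cong {G} {H} nim≡ , kernel-size≤ G H order≤) , enc′
      , t , τ , subst (λ s → t ≤ 480 * s + 480) (sym (*-identityʳ (Graph.size G))) t≤ , run , out
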